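{- The double spider $\mathrm{Sp}(1,1;1,2)$ is an $\operatorname{IR}$-tree of diameter $4$, and it is the unique smallest such tree: every $\operatorname{IR}$-tree of diameter $4$ has at least $7$ vertices, and every $\operatorname{IR}$-tree of diameter $4$ with at most $7$ vertices is isomorphic to $\mathrm{Sp}(1,1;1,2)$.
   Context: All graphs are finite and simple. For $D\subseteq V(G)$, $v\in D$: $\operatorname{PN}(v,D)=N[v]-N[D-\{v\}]$ (closed neighbourhoods). $D$ is irredundant if $\operatorname{PN}(v,D)\ne\varnothing$ for all $v\in D$; $\operatorname{IR}(G)$ is the max size of an irredundant set; an $\operatorname{IR}(G)$-set is an irredundant set of that size. $G(\operatorname{IR})$ has the $\operatorname{IR}(G)$-sets as vertices, $D\sim D'$ iff $D'=(D-\{u\})\cup\{v\}$ for some $u\in D$, $v\in D'$ with $uv\in E(G)$. An $\operatorname{IR}$-tree is a tree $T$ with $T\cong G(\operatorname{IR})$ for some graph $G$. The double star $S(k,n)$ is obtained by joining the centres of stars $K_{1,k}$ and $K_{1,n}$ by an edge; the double spider $\mathrm{Sp}(\ell_1,\dots,\ell_k;m_1,\dots,m_n)$ is obtained from $S(k,n)$ by subdividing the $i$-th edge of the $K_{1,k}$-part $\ell_i-1$ times and the $i$-th edge of the $K_{1,n}$-part $m_i-1$ times. Thus $\mathrm{Sp}(1,1;1,2)$ is the $7$-vertex tree obtained from $S(2,2)$ by subdividing one pendant edge once. -}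

module Defs where

open import Data.Nat using (ℕ; zero; suc; _≤_)
open import Data.Bool using (Bool; true; false; T; _∨_)
open import Data.Fin using (Fin; zero; suc; inject₁; fromℕ)
open import Data.Fin.Subset using (Subset; _∈_; _∪_; _-_; ⁅_⁆; ∣_∣)
open import Data.Product using (Σ; ∃; ∃-syntax; _×_; _,_)
open import Data.Sum using (_⊎_)
open import Relation.Binary.PropositionalEquality using (_≡_; _≢_)
open import Relation.Nullary using (¬_)
open import Function.Bundles using (_↔_; Inverse; _⇔_)

record Graph (n : ℕ) : Set where
  field
    adj   : Fin n → Fin n → Bool
    sym   : ∀ u v → adj u v ≡ adj v u
    irrefl : ∀ u → adj u u ≡ false
open Graph public

Edge : ∀ {n} → Graph n → Fin n → Fin n → Set
Edge G u v = T (adj G u v)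

data Walk {n} (G : Graph n) : Fin n → Fin n → ℕ → Set where
  nil  : ∀ {u} → Walk G u u 0
  cons : ∀ {u w v k} → Edge G u w → Walk G w v k → Walk G u v (suc k)

Connected : ∀ {n} → Graph n → Set
Connected G = ∀ u v → ∃[ k ] Walk G u v k

record Cycle {n} (G : Graph n) : Set where
  field
    len   : ℕ
    c     : Fin (suc (suc (suc len))) → Fin n
    inj   : ∀ i j → c i ≡ c j → i ≡ j
    steps : ∀ (i : Fin (suc (suc len))) → Edge G (c (inject₁ i)) (c (suc i))
    close : Edge G (c (fromℕ (suc (suc len)))) (c zero)

Acyclic : ∀ {n} → Graph n → Set
Acyclic G = ¬ Cycle G

IsTree : ∀ {n} → Graph n → Set
IsTree G = Connected G × Acyclic G

HasDiameter : ∀ {n} → Graph n → ℕ → Set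
HasDiameter G d =
  (∀ u v → ∃[ k ] (k ≤ d × Walk G u v k)) ×
  (∃[ u ] ∃[ v ] (∀ k → Walk G u v k → d ≤ k))

InClosedNbr : ∀ {n} → Graph n → Fin n → Fin n → Set
InClosedNbr G v w = (w ≡ v) ⊎ Edge G v w

InPN : ∀ {n} → Graph n → Fin n → Subset n → Fin n → Set
InPN G v D w =
  InClosedNbr G v w × (∀ u → u ∈ D → u ≢ v → ¬ InClosedNbr G u w)

Irredundant : ∀ {n} → Graph n → Subset n → Set
Irredundant G D = ∀ v → v ∈ D → ∃[ w ] InPN G v D w

IsIRSet : ∀ {n} → Graph n → Subset n → Set
IsIRSet G D = Irredundant G D × (∀ D' → Irredundant G D' → ∣ D' ∣ ≤ ∣ D ∣)

IRAdj : ∀ {n} → Graph n → Subset n → Subset n → Set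
IRAdj G D D' = ∃[ u ] ∃[ v ]
  (u ∈ D × v ∈ D' × Edge G u v × D' ≡ ((D - u) ∪ ⁅ v ⁆))

IsoToIRGraph : ∀ {m n} → Graph m → Graph n → Set
IsoToIRGraph {m} {n} T G = Σ (Fin m → Subset n) λ f →
  (∀ i → IsIRSet G (f i)) ×
  (∀ i j → f i ≡ f j → i ≡ j) ×
  (∀ D → IsIRSet G D → ∃[ i ] f i ≡ D) ×
  (∀ i j → Edge T i j ⇔ IRAdj G (f i) (f j))

IsIRTree : ∀ {m} → Graph m → Set
IsIRTree T = IsTree T × ∃[ n ] Σ (Graph n) λ G → IsoToIRGraph T G

Isomorphic : ∀ {m n} → Graph m → Graph n → Set
Isomorphic {m} {n} G H = Σ (Fin m ↔ Fin n) λ σ →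
  ∀ u v → adj G u v ≡ adj H (Inverse.to σ u) (Inverse.to σ v)

-- The double spider Sp(1,1;1,2) on Fin 7:
--   0 = centre of the K_{1,2}-part, 1 = centre of the other part,
--   2,3 = leaves at 0 (legs of length 1), 4 = leaf at 1 (leg of length 1),
--   5,6 = leg 1–5–6 of length 2.
-- Edges: 01, 02, 03, 14, 15, 56.

spE : Fin 7 → Fin 7 → Bool
spE zero (suc zero) = true
spE zero (suc (suc zero)) = true
spE zero (suc (suc (suc zero))) = true
spE (suc zero) (suc (suc (suc (suc zero)))) = true
spE (suc zero) (suc (suc (suc (suc (suc zero))))) = true
spE (suc (suc (suc (suc (suc zero))))) (suc (suc (suc (suc (suc (suc zero)))))) = true
spE _ _ = false

spAdj : Fin 7 → Fin 7 → Bool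
spAdj u v = spE u v ∨ spE v u

open import Data.Bool.Properties using (∨-comm)

spSym : ∀ u v → spAdj u v ≡ spAdj v u
spSym u v = ∨-comm (spE u v) (spE v u)

spIrr : ∀ u → spAdj u u ≡ false
spIrr zero = _≡_.refl
spIrr (suc zero) = _≡_.refl
spIrr (suc (suc zero)) = _≡_.refl
spIrr (suc (suc (suc zero))) = _≡_.refl
spIrr (suc (suc (suc (suc zero)))) = _≡_.refl
spIrr (suc (suc (suc (suc (suc zero))))) = _≡_.refl
spIrr (suc (suc (suc (suc (suc (suc zero)))))) = _≡_.refl

Sp11-12 : Graph 7
Sp11-12 = record { adj = spAdj ; sym = spSym ; irrefl = spIrr }

{-# OPTIONS --safe #-}

-- Replacing every vertex of an IR-set by one of its private neighbours gives
-- another IR-set.  Let H = G(IR) be a tree of diameter 4.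
--
-- If all edges inside an IR-set X join two vertices a and b, then exchanging a
-- and b for private neighbours a′ and b′, separately and together, produces a
-- 4-cycle in H; so X is independent.  Three independent IR-sets cannot form a path
-- in H either: they would give a triangle, a 4-cycle or a larger irredundant
-- set.  Hence one of the three inner sets of a diametral path is dependent; call
-- it X.  Its eccentricity is at most 3, so X reaches its flip in at most 3
-- steps, and by the first remark these steps must be u₁ → v₁, u₂ → v₂, u₃ → v₃
-- with all uᵢ non-isolated in X and vᵢ a private neighbour of uᵢ.  The two sets
-- W₁, W₂ strictly between are then independent, which forces the edges u₁u₃,
-- v₁v₃ and two further IR-sets W₁ - u₃ + u₁ and W₂ - v₁ + v₃.  Thus H contains
-- S(2,2), a tree of diameter 3, so it has a seventh vertex; if there is no
-- eighth, the seventh hangs at a leaf.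
module Submission where

open import Defs
open import Data.Nat using (ℕ; zero; suc; _≤_; _<_; z≤n; s≤s; _+_)
open import Data.Nat.Properties as ℕ using (≤-refl; ≤-trans; m≤n⇒m≤1+n; <⇒≱; +-mono-≤)
open import Data.Bool using (Bool; true; false; T; T?)
open import Data.Bool.Properties as Bool using (T-≡; T-∨)
open import Data.Fin using (Fin; zero; suc; inject₁; fromℕ; toℕ; #_)
open import Data.Fin.Properties
  using (_≟_; any?; all?; suc-injective; injective⇒≤; toℕ-inject₁)
open import Data.Fin.Relation.Unary.Top using (view; ‵fromℕ; ‵inject₁)
open import Data.Fin.Subset
  using (Subset; _∈_; _∉_; _⊆_; _∪_; _─_; _-_; ⁅_⁆; ∣_∣; inside; outside)
  renaming (⊥ to ∅)
open import Data.Fin.Subset.Properties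
  using (_∈?_; anySubset?; ∉⊥; ⊆-antisym; x∈p∪q⁺; x∈p∪q⁻; x∈⁅x⁆; x∈⁅y⁆⇒x≡y; x∈p∧x≢y⇒x∈p-y;
         p─q⊆p; p⊆p∪q; p⊂q⇒∣p∣<∣q∣; x∈p⇒∣p-x∣<∣p∣)
open import Data.List using (List; []; _∷_; foldr)
open import Data.List.Relation.Unary.All as All using ([]; _∷_)
open import Data.List.Relation.Unary.Any as Any using ()
open import Data.Vec using (Vec; []; _∷_; tabulate; lookup; here; there)
open import Data.Vec.Properties as Vec using (lookup∘tabulate; []=⇒lookup; lookup⇒[]=)
open import Data.Vec.Relation.Unary.All using ([]; _∷_)
open import Data.Vec.Relation.Unary.AllPairs using ([]; _∷_)
open import Data.Vec.Relation.Unary.Unique.Propositional using (Unique)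
open import Data.Vec.Relation.Unary.Unique.Propositional.Properties using (lookup-injective)
open import Data.Product using (∃-syntax; Σ-syntax; _×_; _,_; proj₁; proj₂)
open import Data.Product.Properties as Product using ()
open import Data.Sum using (_⊎_; inj₁; inj₂; [_,_]′)
open import Data.Unit using (⊤; tt)
open import Data.Empty using (⊥; ⊥-elim)
open import Function using (_∘_; id)
open import Function.Bundles using (Equivalence; mk↔ₛ′; mk⇔)
open import Relation.Binary.PropositionalEquality
  using (_≡_; _≢_; refl; trans; cong; subst; subst₂; ≢-sym) renaming (sym to ≡-sym)
open import Relation.Nullary using (¬_; Dec; yes; no; contradiction)
open import Relation.Nullary.Decidable
  using (_⊎-dec_; _×-dec_; _→-dec_; ¬?; map′; isYes; True; toWitness; toWitnessFalse;
         fromWitness; decidable-stable)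

-- Walks and cycles

edge-sym : ∀ {n} (G : Graph n) {u v} → Edge G u v → Edge G v u
edge-sym G {u} {v} = subst T (Graph.sym G u v)

edge-irrefl : ∀ {n} (G : Graph n) {u} → ¬ Edge G u u
edge-irrefl G {u} e = subst T (irrefl G u) e

edge⇒≢ : ∀ {n} (G : Graph n) {u v} → Edge G u v → u ≢ v
edge⇒≢ G e refl = edge-irrefl G e

module _ {n} {G : Graph n} where

  infix 4 _∈ʷ_

  _∈ʷ_ : ∀ {u v k} → Fin n → Walk G u v k → Set
  x ∈ʷ nil {u}        = x ≡ u
  x ∈ʷ cons {u} e w = x ≡ u ⊎ x ∈ʷ w

  _∈ʷ?_ : ∀ {u v k} x (w : Walk G u v k) → Dec (x ∈ʷ w)
  x ∈ʷ? nil {u}      = x ≟ u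
  x ∈ʷ? cons {u} e w = (x ≟ u) ⊎-dec (x ∈ʷ? w)

  Simple : ∀ {u v k} → Walk G u v k → Set
  Simple nil            = ⊤
  Simple (cons {u} e w) = ¬ u ∈ʷ w × Simple w

  start∈ : ∀ {u v k} (w : Walk G u v k) → u ∈ʷ w
  start∈ nil        = refl
  start∈ (cons _ _) = inj₁ refl

  suffix : ∀ {u v k x} (w : Walk G u v k) → x ∈ʷ w →
    ∃[ l ] (l ≤ k × Σ[ w′ ∈ Walk G x v l ]
      ((Simple w → Simple w′) × (∀ y → y ∈ʷ w′ → y ∈ʷ w)))
  suffix nil        refl        = 0 , z≤n , nil , (λ s → s) , λ _ p → p
  suffix (cons e w) (inj₁ refl) = _ , ≤-refl , cons e w , (λ s → s) , λ _ p → p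
  suffix (cons e w) (inj₂ x∈w) =
    let l , l≤k , w′ , simple , sub = suffix w x∈w
    in l , m≤n⇒m≤1+n l≤k , w′ , simple ∘ proj₂ , λ y → inj₂ ∘ sub y

  simplify : ∀ {u v k} (w : Walk G u v k) →
    ∃[ l ] Σ[ w′ ∈ Walk G u v l ] (Simple w′ × (∀ y → y ∈ʷ w′ → y ∈ʷ w))
  simplify nil = 0 , nil , tt , λ _ p → p
  simplify (cons {u} e w) with simplify w
  ... | l , w′ , simple , sub with u ∈ʷ? w′
  ...   | no u∉w′ = suc l , cons e w′ , (u∉w′ , simple) ,
                    λ y → [ inj₁ , inj₂ ∘ sub y ]′
  ...   | yes u∈w′ =
    let l′ , _ , w″ , simple″ , sub″ = suffix w′ u∈w′
    in l′ , w″ , simple″ simple , λ y → inj₂ ∘ sub y ∘ sub″ y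

  revAppend : ∀ {u v z k l} (p : Walk G u v k) (q : Walk G u z l) →
    ∃[ m ] Σ[ r ∈ Walk G v z m ] (∀ y → y ∈ʷ r → y ∈ʷ p ⊎ y ∈ʷ q)
  revAppend nil        q = _ , q , λ _ → inj₂
  revAppend (cons e p) q =
    let m , r , sub = revAppend p (cons (edge-sym G e) q)
    in m , r , λ y y∈r →
      [ inj₁ ∘ inj₂ , [ (λ { refl → inj₁ (inj₂ (start∈ p)) }) , inj₂ ]′ ]′ (sub y y∈r)

  joinAtEnd : ∀ {u v z k l} (p : Walk G u z k) (q : Walk G v z l) →
    ∃[ m ] Σ[ r ∈ Walk G u v m ] (∀ y → y ∈ʷ r → y ∈ʷ p ⊎ y ∈ʷ q)
  joinAtEnd p q =
    let _ , p⁻¹ , subp = revAppend p nil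
        _ , q⁻¹ , subq = revAppend q nil
        _ , r , sub    = revAppend p⁻¹ q⁻¹
    in _ , r , λ y y∈r → [ inj₁ ∘ [ (λ z → z) , (λ { refl → start∈ p }) ]′ ∘ subp y
                         , inj₂ ∘ [ (λ z → z) , (λ { refl → start∈ q }) ]′ ∘ subq y ]′ (sub y y∈r)

  at : ∀ {u v k} → Walk G u v k → Fin (suc k) → Fin n
  at {u} w          zero    = u
  at     (cons e w) (suc i) = at w i

  at-∈ : ∀ {u v k} (w : Walk G u v k) i → at w i ∈ʷ w
  at-∈ nil        zero    = refl
  at-∈ (cons e w) zero    = inj₁ refl
  at-∈ (cons e w) (suc i) = inj₂ (at-∈ w i)

  at-injective : ∀ {u v k} (w : Walk G u v k) → Simple w →
    ∀ i j → at w i ≡ at w j → i ≡ j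
  at-injective w          s       zero    zero    _  = refl
  at-injective (cons e w) (u∉ , _) zero   (suc j) eq =
    contradiction (subst (_∈ʷ w) (≡-sym eq) (at-∈ w j)) u∉
  at-injective (cons e w) (u∉ , _) (suc i) zero   eq =
    contradiction (subst (_∈ʷ w) eq (at-∈ w i)) u∉
  at-injective (cons e w) (_ , s) (suc i) (suc j) eq =
    cong suc (at-injective w s i j eq)

  at-edge : ∀ {u v k} (w : Walk G u v k) (i : Fin k) →
    Edge G (at w (inject₁ i)) (at w (suc i))
  at-edge (cons e w) zero    = e
  at-edge (cons e w) (suc i) = at-edge w i

  at-last : ∀ {u v k} (w : Walk G u v k) → at w (fromℕ k) ≡ v
  at-last nil        = refl
  at-last (cons e w) = at-last w

  -- A simple walk with at least two edges has three vertices or more, so a closing edge yields a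
  -- genuine cycle. Every cycle used to contradict acyclicity is built this way.
  closeSimple : ∀ {u v k} (w : Walk G u v (suc (suc k))) → Simple w →
    Edge G v u → Cycle G
  closeSimple {u} {v} {k} w simple e = record
    { len   = k
    ; c     = at w
    ; inj   = at-injective w simple
    ; steps = at-edge w
    ; close = subst (λ x → Edge G x u) (≡-sym (at-last w)) e
    }

  triangle : ∀ {a b c} → a ≢ b → b ≢ c → a ≢ c →
    Edge G a b → Edge G b c → Edge G c a → Cycle G
  triangle a≢b b≢c a≢c ab bc ca = closeSimple (cons ab (cons bc nil))
    ([ a≢b , a≢c ]′ , b≢c , tt) ca

  square : ∀ {a b c d} → a ≢ c → b ≢ d →
    Edge G a b → Edge G b c → Edge G c d → Edge G d a → Cycle G
  square a≢c b≢d ab bc cd da = closeSimple (cons ab (cons bc (cons cd nil)))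
    ( [ edge⇒≢ G ab , [ a≢c , edge⇒≢ G da ∘ ≡-sym ]′ ]′
    , [ edge⇒≢ G bc , b≢d ]′ , edge⇒≢ G cd , tt) da

  -- If x were on neither walk from b and c to w, then b and c would be
  -- connected in G - x, and x would close a cycle.
  branching-eccentricity : ∀ {d} → Acyclic G →
    (∀ u v → ∃[ k ] (k ≤ suc d × Walk G u v k)) →
    ∀ {x b c} → b ≢ c → Edge G x b → Edge G x c →
    ∀ w → ∃[ k ] (k ≤ d × Walk G x w k)
  branching-eccentricity {d} acyclic short {x} {b} {c} b≢c xb xc w =
    decide (short b w) (short c w)
    where
    Short : Set
    Short = ∃[ k ] (k ≤ d × Walk G x w k)

    through : ∀ {y k} → Edge G x y → k ≤ suc d → (p : Walk G y w k) →
      x ∈ʷ p → Short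
    through xy _       nil        refl        = ⊥-elim (edge-irrefl G xy)
    through xy _       (cons e p) (inj₁ refl) = ⊥-elim (edge-irrefl G xy)
    -- The walk starts at a neighbour of `x`, so its part from `x` onwards lacks at least the first
    -- edge; this turns the bound `suc d` into `d`.
    through xy (s≤s k≤d) (cons e p) (inj₂ x∈p) =
      let l , l≤k , q , _ = suffix p x∈p in l , ≤-trans l≤k k≤d , q

    around : ∀ {k} (r : Walk G b c k) → Simple r → ¬ x ∈ʷ r → ⊥
    around nil          _      _   = b≢c refl
    around (cons e r) simple x∉r =
      acyclic (closeSimple (cons xb (cons e r)) (x∉r , simple) (edge-sym G xc))

    decide : ∃[ k ] (k ≤ suc d × Walk G b w k) →
      ∃[ k ] (k ≤ suc d × Walk G c w k) → Short
    decide (_ , k≤ , p) (_ , l≤ , q) with x ∈ʷ? p | x ∈ʷ? q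
    ... | yes x∈p | _       = through xb k≤ p x∈p
    ... | no  _   | yes x∈q = through xc l≤ q x∈q
    ... | no  x∉p | no x∉q  =
      let _ , r , sub         = joinAtEnd p q
          _ , r′ , simple , sub′ = simplify r
      in ⊥-elim (around r′ simple ([ x∉p , x∉q ]′ ∘ sub x ∘ sub′ x))

module _ {m n} (S : Graph m) (G : Graph n) (σ : Fin m → Fin n)
  (σ-injective : ∀ i j → σ i ≡ σ j → i ≡ j)
  (σ-hom : ∀ {i j} → Edge S i j → Edge G (σ i) (σ j)) where

  mapʷ : ∀ {u v k} → Walk S u v k → Walk G (σ u) (σ v) k
  mapʷ nil        = nil
  mapʷ (cons e w) = cons (σ-hom e) (mapʷ w)

  ∈ʷ-map⁻ : ∀ {u v k x} (w : Walk S u v k) → σ x ∈ʷ mapʷ w → x ∈ʷ w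
  ∈ʷ-map⁻ nil        eq        = σ-injective _ _ eq
  ∈ʷ-map⁻ (cons e w) (inj₁ eq) = inj₁ (σ-injective _ _ eq)
  ∈ʷ-map⁻ (cons e w) (inj₂ p)  = inj₂ (∈ʷ-map⁻ w p)

  Simple-map : ∀ {u v k} (w : Walk S u v k) → Simple w → Simple (mapʷ w)
  Simple-map nil        _        = tt
  Simple-map (cons e w) (u∉ , s) = u∉ ∘ ∈ʷ-map⁻ w , Simple-map w s

  -- If `i` and `j` were distinct and not adjacent in `S`, a simple walk between them would have at
  -- least two edges, and its image would form a cycle with the edge of `G`.
  hom-reflects-edges : Connected S → Acyclic G →
    ∀ {i j} → Edge G (σ i) (σ j) → Edge S i j
  hom-reflects-edges connected acyclic {i} {j} e with simplify (proj₂ (connected i j))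
  ... | _ , nil                , _      , _ = ⊥-elim (edge-irrefl G e)
  ... | _ , cons e′ nil        , _      , _ = e′
  ... | _ , w@(cons _ (cons _ _)) , simple , _ =
    ⊥-elim (acyclic (closeSimple (mapʷ w) (Simple-map w simple) (edge-sym G e)))

-- Exchanging vertices in irredundant sets

x∈p─q⇒x∉q : ∀ {n} {p q : Subset n} {x} → x ∈ p ─ q → x ∉ q
x∈p─q⇒x∉q {p = inside ∷ p} {outside ∷ q} here         ()
x∈p─q⇒x∉q {p = _ ∷ p}      {outside ∷ q} (there x∈) (there x∈q) = x∈p─q⇒x∉q x∈ x∈q
x∈p─q⇒x∉q {p = _ ∷ p}      {inside ∷ q}  (there x∈) (there x∈q) = x∈p─q⇒x∉q x∈ x∈q

injection⇒∣p∣≤∣q∣ : ∀ {m n} (p : Subset m) (q : Subset n) (h : Fin m → Fin n) →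
  (∀ {x} → x ∈ p → h x ∈ q) →
  (∀ {x y} → x ∈ p → y ∈ p → h x ≡ h y → x ≡ y) → ∣ p ∣ ≤ ∣ q ∣
injection⇒∣p∣≤∣q∣ []            q h into inj = z≤n
injection⇒∣p∣≤∣q∣ (outside ∷ p) q h into inj =
  injection⇒∣p∣≤∣q∣ p q (h ∘ suc) (into ∘ there)
    (λ x∈ y∈ → suc-injective ∘ inj (there x∈) (there y∈))
injection⇒∣p∣≤∣q∣ (inside ∷ p)  q h into inj =
  ≤-trans (s≤s (injection⇒∣p∣≤∣q∣ p (q - h zero) (h ∘ suc)
      (λ x∈ → x∈p∧x≢y⇒x∈p-y (into (there x∈)) (λ eq → contradiction (inj (there x∈) here eq) λ ()))
      (λ x∈ y∈ → suc-injective ∘ inj (there x∈) (there y∈))))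
    (x∈p⇒∣p-x∣<∣p∣ (into here))

module _ {n} {P : Fin n → Set} (P? : ∀ x → Dec (P x)) where

  comprehension : Subset n
  comprehension = tabulate (λ x → isYes (P? x))

  ∈-comprehension⁺ : ∀ {x} → P x → x ∈ comprehension
  ∈-comprehension⁺ {x} px = lookup⇒[]= x comprehension
    (trans (lookup∘tabulate _ x) (Equivalence.to T-≡ (fromWitness px)))

  ∈-comprehension⁻ : ∀ {x} → x ∈ comprehension → P x
  ∈-comprehension⁻ {x} x∈ = toWitness (Equivalence.from T-≡
    (trans (≡-sym (lookup∘tabulate _ x)) ([]=⇒lookup x∈)))

-- Written as in `IRAdj`, so that the equation required there holds by `refl`.
swap : ∀ {n} → Subset n → Fin n → Fin n → Subset n
swap D u v = (D - u) ∪ ⁅ v ⁆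

module _ {n} {D : Subset n} {u v : Fin n} where

  ∈-swap⁻ : ∀ {x} → x ∈ swap D u v → (x ∈ D × x ≢ u) ⊎ x ≡ v
  ∈-swap⁻ {x} x∈ with x∈p∪q⁻ (D - u) ⁅ v ⁆ x∈
  ... | inj₂ x∈v   = inj₂ (x∈⁅y⁆⇒x≡y v x∈v)
  ... | inj₁ x∈D-u = inj₁ (p─q⊆p D ⁅ u ⁆ x∈D-u , λ { refl → x∈p─q⇒x∉q x∈D-u (x∈⁅x⁆ u) })

  swap-keeps : ∀ {x} → x ∈ D → x ≢ u → x ∈ swap D u v
  swap-keeps x∈ x≢ = x∈p∪q⁺ (inj₁ (x∈p∧x≢y⇒x∈p-y x∈ x≢))

  swap-adds : v ∈ swap D u v
  swap-adds = x∈p∪q⁺ (inj₂ (x∈⁅x⁆ v))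

  swap-removes : u ≢ v → u ∉ swap D u v
  swap-removes u≢v u∈ with ∈-swap⁻ u∈
  ... | inj₁ (_ , u≢u) = u≢u refl
  ... | inj₂ u≡v       = u≢v u≡v

  swap-avoids : ∀ {x} → x ∉ D → x ≢ v → x ∉ swap D u v
  swap-avoids x∉D x≢v x∈ with ∈-swap⁻ x∈
  ... | inj₁ (x∈D , _) = x∉D x∈D
  ... | inj₂ x≡v       = x≢v x≡v

  ∣D∣≤∣swap∣ : v ∉ D → ∣ D ∣ ≤ ∣ swap D u v ∣
  ∣D∣≤∣swap∣ v∉D = injection⇒∣p∣≤∣q∣ D (swap D u v) move into move-injective
    where
    move : Fin n → Fin n
    move x with x ≟ u
    ... | yes _ = v
    ... | no  _ = x

    into : ∀ {x} → x ∈ D → move x ∈ swap D u v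
    into {x} x∈ with x ≟ u
    ... | yes _  = swap-adds
    ... | no x≢u = swap-keeps x∈ x≢u

    move-injective : ∀ {x y} → x ∈ D → y ∈ D → move x ≡ move y → x ≡ y
    move-injective {x} {y} x∈ y∈ eq with x ≟ u | y ≟ u
    ... | yes refl | yes refl = refl
    ... | yes _    | no _     = contradiction (subst (_∈ D) (≡-sym eq) y∈) v∉D
    ... | no _     | yes _    = contradiction (subst (_∈ D) eq x∈) v∉D
    ... | no _     | no _     = eq

-- Makes the two ways round the square in `no-private-square` end at the same set.
swap-comm : ∀ {n} {D : Subset n} {a a′ b b′} → a ≢ b′ → b ≢ a′ →
  swap (swap D a a′) b b′ ≡ swap (swap D b b′) a a′
swap-comm {n} {D} a≢b′ b≢a′ = ⊆-antisym (half a≢b′ b≢a′) (half b≢a′ a≢b′)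
  where
  half : ∀ {a a′ b b′} → a ≢ b′ → b ≢ a′ →
    swap (swap D a a′) b b′ ⊆ swap (swap D b b′) a a′
  half a≢b′ b≢a′ x∈ with ∈-swap⁻ x∈
  ... | inj₂ refl = swap-keeps swap-adds (≢-sym a≢b′)
  ... | inj₁ (x∈₁ , x≢b) with ∈-swap⁻ x∈₁
  ...   | inj₂ refl        = swap-adds
  ...   | inj₁ (x∈D , x≢a) = swap-keeps (swap-keeps x∈D x≢b) x≢a

swap-swap : ∀ {n} {D : Subset n} {a b c} → b ∉ D → swap (swap D a b) b c ≡ swap D a c
swap-swap {D = D} {a} {b} {c} b∉D = ⊆-antisym to from
  where
  to : swap (swap D a b) b c ⊆ swap D a c
  to x∈ with ∈-swap⁻ x∈
  ... | inj₂ refl = swap-adds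
  ... | inj₁ (x∈₁ , x≢b) with ∈-swap⁻ x∈₁
  ...   | inj₂ x≡b         = contradiction x≡b x≢b
  ...   | inj₁ (x∈D , x≢a) = swap-keeps x∈D x≢a

  from : swap D a c ⊆ swap (swap D a b) b c
  from x∈ with ∈-swap⁻ x∈
  ... | inj₂ refl        = swap-adds
  ... | inj₁ (x∈D , x≢a) = swap-keeps (swap-keeps x∈D x≢a) λ { refl → b∉D x∈D }

separated : ∀ {n} {A B : Subset n} {x} → x ∈ A → x ∉ B → A ≢ B
separated x∈A x∉B refl = x∉B x∈A

-- Private neighbours and independent sets

module _ {n} (G : Graph n) where

  Independent : Subset n → Set
  Independent D = ∀ {x y} → x ∈ D → y ∈ D → ¬ Edge G x y

  independent? : ∀ D → Independent D ⊎ ∃[ x ] ∃[ y ] (x ∈ D × y ∈ D × Edge G x y)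
  independent? D with any? (λ x → any? (λ y → (x ∈? D) ×-dec (y ∈? D) ×-dec T? (adj G x y)))
  ... | yes p = inj₂ p
  ... | no ¬p = inj₁ λ x∈ y∈ e → ¬p (_ , _ , x∈ , y∈ , e)

  closedNbr-sym : ∀ {x y} → InClosedNbr G x y → InClosedNbr G y x
  closedNbr-sym (inj₁ eq) = inj₁ (≡-sym eq)
  closedNbr-sym (inj₂ e)  = inj₂ (edge-sym G e)

  isolated⇒self-PN : ∀ {D x} → (∀ {y} → y ∈ D → ¬ Edge G x y) → InPN G x D x
  isolated⇒self-PN isolated = inj₁ refl , λ where
    u u∈ u≢x (inj₁ eq) → u≢x (≡-sym eq)
    u u∈ u≢x (inj₂ e)  → isolated u∈ (edge-sym G e)

  independent⇒irredundant : ∀ {D} → Independent D → Irredundant G D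
  independent⇒irredundant ind v v∈ = v , isolated⇒self-PN (ind v∈)

  PN-unique : ∀ {D x y w} → y ∈ D → InPN G x D w → Edge G y w → y ≡ x
  PN-unique {x = x} {y} y∈ pn e with y ≟ x
  ... | yes y≡x = y≡x
  ... | no y≢x  = contradiction (inj₂ e) (proj₂ pn _ y∈ y≢x)

  -- The neighbour `y` in `D` dominates `x`, so `x` is not its own private neighbour.
  PN-edge : ∀ {D x y w} → y ∈ D → Edge G x y → InPN G x D w → Edge G x w
  PN-edge y∈ xy (inj₂ e    , _) = e
  PN-edge y∈ xy (inj₁ refl , p) = contradiction (inj₂ (edge-sym G xy))
    (p _ y∈ (≢-sym (edge⇒≢ G xy)))

  external-PN : ∀ {D x w} → Edge G x w → InPN G x D w → w ∉ D
  external-PN e pn w∈ = proj₂ pn _ w∈ (≢-sym (edge⇒≢ G e)) (inj₁ refl)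

  -- Being private works in both directions: `x` dominates `φ y` only when `y` is `x`, so `x` serves
  -- as a private neighbour of `φ x` in the new set.
  flip-irredundant : ∀ {D D′} (φ : Fin n → Fin n) →
    (∀ {x} → x ∈ D → InPN G x D (φ x)) →
    (∀ {w} → w ∈ D′ → ∃[ x ] (x ∈ D × w ≡ φ x)) → Irredundant G D′
  flip-irredundant {D} {D′} φ φ-PN cover w w∈ with cover w∈
  ... | x , x∈ , refl = x , closedNbr-sym (proj₁ (φ-PN x∈)) , exclusive
    where
    exclusive : ∀ u → u ∈ D′ → u ≢ φ x → ¬ InClosedNbr G u x
    exclusive u u∈ u≢ with cover u∈
    ... | y , y∈ , refl = λ near →
      proj₂ (φ-PN y∈) x x∈ (λ { refl → u≢ refl }) (closedNbr-sym near)

  larger⇒IRSet : ∀ {D D′} → IsIRSet G D → Irredundant G D′ → ∣ D ∣ ≤ ∣ D′ ∣ → IsIRSet G D′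
  larger⇒IRSet (_ , max) irr le = irr , λ E irrE → ≤-trans (max E irrE) le

  swap-IRSet : ∀ {D u v} → IsIRSet G D → v ∉ D → Irredundant G (swap D u v) →
    IsIRSet G (swap D u v)
  swap-IRSet ir v∉ irr = larger⇒IRSet ir irr (∣D∣≤∣swap∣ v∉)

  swap-IRAdj : ∀ {D u v} → u ∈ D → Edge G u v → IRAdj G D (swap D u v)
  swap-IRAdj u∈ e = _ , _ , u∈ , swap-adds , e , refl

  -- The only neighbour of `w` in `D` is `x`, which leaves, so `w` brings in no edge.
  PN-swap-independent : ∀ {D x w} → Edge G x w → InPN G x D w →
    (∀ {y z} → y ∈ D → z ∈ D → y ≢ x → z ≢ x → ¬ Edge G y z) →
    Independent (swap D x w)
  PN-swap-independent e pn ind p∈ q∈ pq with ∈-swap⁻ p∈ | ∈-swap⁻ q∈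
  ... | inj₁ (p∈D , p≢x) | inj₁ (q∈D , q≢x) = ind p∈D q∈D p≢x q≢x pq
  ... | inj₁ (p∈D , p≢x) | inj₂ refl        = p≢x (PN-unique p∈D pn pq)
  ... | inj₂ refl        | inj₁ (q∈D , q≢x) = q≢x (PN-unique q∈D pn (edge-sym G pq))
  ... | inj₂ refl        | inj₂ refl        = edge-irrefl G pq

  module _ {D : Subset n} {a b a′ b′ : Fin n} where

    -- This is a flip in which all vertices other than `a` and `b` are their own private neighbours.
    double-swap-irredundant : a ∈ D → b ∈ D → a ≢ b → InPN G a D a′ → InPN G b D b′ →
      (∀ {x} → x ∈ D → x ≢ a → x ≢ b → InPN G x D x) →
      Irredundant G (swap (swap D a a′) b b′)
    double-swap-irredundant a∈ b∈ a≢b pna pnb others = flip-irredundant φ φ-PN cover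
      where
      φ : Fin n → Fin n
      φ x with x ≟ a | x ≟ b
      ... | yes _ | _     = a′
      ... | no  _ | yes _ = b′
      ... | no  _ | no  _ = x

      φ-PN : ∀ {x} → x ∈ D → InPN G x D (φ x)
      φ-PN {x} x∈ with x ≟ a | x ≟ b
      ... | yes refl | _        = pna
      ... | no  _    | yes refl = pnb
      ... | no  x≢a  | no  x≢b  = others x∈ x≢a x≢b

      φ-a : a′ ≡ φ a
      φ-a with a ≟ a
      ... | yes _  = refl
      ... | no a≢a = contradiction refl a≢a

      φ-b : b′ ≡ φ b
      φ-b with b ≟ a | b ≟ b
      ... | yes b≡a | _      = contradiction (≡-sym b≡a) a≢b
      ... | no  _   | yes _  = refl
      ... | no  _   | no b≢b = contradiction refl b≢b

      φ-other : ∀ {x} → x ≢ a → x ≢ b → x ≡ φ x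
      φ-other {x} x≢a x≢b with x ≟ a | x ≟ b
      ... | yes x≡a | _       = contradiction x≡a x≢a
      ... | no  _   | yes x≡b = contradiction x≡b x≢b
      ... | no  _   | no  _   = refl

      cover : ∀ {w} → w ∈ swap (swap D a a′) b b′ → ∃[ x ] (x ∈ D × w ≡ φ x)
      cover w∈ with ∈-swap⁻ w∈
      ... | inj₂ refl = b , b∈ , φ-b
      ... | inj₁ (w∈₁ , w≢b) with ∈-swap⁻ w∈₁
      ...   | inj₂ refl        = a , a∈ , φ-a
      ...   | inj₁ (w∈D , w≢a) = _ , w∈D , φ-other w≢a w≢b

  -- The flip of an irredundant set

  module Flip {X : Subset n} (irredundant : Irredundant G X) where

    HasNbr : Fin n → Set
    HasNbr x = ∃[ y ] (y ∈ X × Edge G x y)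

    hasNbr? : ∀ x → Dec (HasNbr x)
    hasNbr? x = any? (λ y → (y ∈? X) ×-dec T? (adj G x y))

    -- Isolated vertices of `X` stay fixed even if they have other private neighbours, so the flip
    -- moves only vertices with a neighbour in `X`. Outside `X` the value is a mere default.
    φ : Fin n → Fin n
    φ x with x ∈? X | hasNbr? x
    ... | yes x∈ | yes _ = proj₁ (irredundant x x∈)
    ... | _      | _     = x

    φ-PN : ∀ {x} → x ∈ X → InPN G x X (φ x)
    φ-PN {x} x∈ with x ∈? X | hasNbr? x
    ... | yes x∈ | yes _     = proj₂ (irredundant x x∈)
    ... | yes x∈ | no alone  = isolated⇒self-PN λ y∈ e → alone (_ , y∈ , e)
    ... | no x∉  | _         = contradiction x∈ x∉

    φ-edge : ∀ {x} → x ∈ X → HasNbr x → Edge G x (φ x)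
    φ-edge x∈ (y , y∈ , e) = PN-edge y∈ e (φ-PN x∈)

    φ-injective : ∀ {x y} → x ∈ X → y ∈ X → φ x ≡ φ y → x ≡ y
    φ-injective {x} {y} x∈ y∈ eq with x ≟ y
    ... | yes x≡y = x≡y
    ... | no x≢y  = contradiction (subst (InClosedNbr G x) eq (proj₁ (φ-PN x∈)))
                                  (proj₂ (φ-PN y∈) x x∈ x≢y)

    inImage? : ∀ w → Dec (∃[ x ] (x ∈ X × w ≡ φ x))
    inImage? w = any? (λ x → (x ∈? X) ×-dec (w ≟ φ x))

    image : Subset n
    image = comprehension inImage?

    φ∈image : ∀ {x} → x ∈ X → φ x ∈ image
    φ∈image x∈ = ∈-comprehension⁺ inImage? (_ , x∈ , refl)

    image-IRSet : IsIRSet G X → IsIRSet G image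
    image-IRSet ir = larger⇒IRSet ir
      (flip-irredundant φ φ-PN (∈-comprehension⁻ inImage?))
      (injection⇒∣p∣≤∣q∣ X image φ φ∈image φ-injective)

    -- Suppose `x` is `φ y`. If `y` differs from `x`, then `x` lies in `X` and dominates itself, so
    -- it is not private to `y`; if `y` is `x`, then `φ` would fix a vertex that it moves along an
    -- edge. Hence any sequence of swaps from `X` to its flip removes every non-isolated vertex.
    nonisolated∉image : ∀ {x} → x ∈ X → HasNbr x → x ∉ image
    nonisolated∉image {x} x∈ has x∈image with ∈-comprehension⁻ inImage? x∈image
    ... | y , y∈ , refl with φ y ≟ y
    ...   | no φy≢y = proj₂ (φ-PN y∈) (φ y) x∈ φy≢y (inj₁ refl)
    ...   | yes φy≡y = edge⇒≢ G (φ-edge y∈ (subst HasNbr φy≡y has)) (≡-sym φy≡y)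

-- IR-sets arranged as a tree

record DoubleStar {m} (T : Graph m) : Set where
  constructor doubleStar
  field
    {c d p q r s} : Fin m
    distinct : Unique (c ∷ d ∷ p ∷ q ∷ r ∷ s ∷ [])
    cd : Edge T c d
    cp : Edge T c p
    cq : Edge T c q
    dr : Edge T d r
    ds : Edge T d s

module _ {m n} {T : Graph m} {G : Graph n} (iso : IsoToIRGraph T G) (acyclic : Acyclic T) where

  private
    f : Fin m → Subset n
    f = proj₁ iso

    f-IRSet : ∀ i → IsIRSet G (f i)
    f-IRSet = proj₁ (proj₂ iso)

    f-adj : ∀ {i j} → Edge T i j → IRAdj G (f i) (f j)
    f-adj = Equivalence.to (proj₂ (proj₂ (proj₂ (proj₂ iso))) _ _)

    f-injective : ∀ i j → f i ≡ f j → i ≡ j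
    f-injective = proj₁ (proj₂ (proj₂ iso))

    f-onto : ∀ A → IsIRSet G A → ∃[ i ] f i ≡ A
    f-onto = proj₁ (proj₂ (proj₂ (proj₂ iso)))

    vertex : ∀ {A} → IsIRSet G A → Fin m
    vertex ir = proj₁ (f-onto _ ir)

    f-vertex : ∀ {A} (ir : IsIRSet G A) → f (vertex ir) ≡ A
    f-vertex ir = proj₂ (f-onto _ ir)

    edge : ∀ {A B} (ia : IsIRSet G A) (ib : IsIRSet G B) → IRAdj G A B →
      Edge T (vertex ia) (vertex ib)
    edge ia ib = Equivalence.from (proj₂ (proj₂ (proj₂ (proj₂ iso))) _ _) ∘
      subst₂ (IRAdj G) (≡-sym (f-vertex ia)) (≡-sym (f-vertex ib))

    vertex-≢ : ∀ {A B} (ia : IsIRSet G A) (ib : IsIRSet G B) → A ≢ B → vertex ia ≢ vertex ib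
    vertex-≢ ia ib A≢B eq =
      A≢B (trans (≡-sym (f-vertex ia)) (trans (cong f eq) (f-vertex ib)))

  -- The corners are `D`, the two single exchanges and the double exchange. The single ones are
  -- irredundant by assumption, the double one because it is a flip of `D`.
  no-private-square : ∀ {D a b a′ b′} → IsIRSet G D → a ∈ D → b ∈ D → a ≢ b →
    Edge G a a′ → InPN G a D a′ → Edge G b b′ → InPN G b D b′ →
    (∀ {x} → x ∈ D → x ≢ a → x ≢ b → InPN G x D x) →
    Irredundant G (swap D a a′) → Irredundant G (swap D b b′) → ⊥
  no-private-square {D} {a} {b} {a′} {b′} ir a∈ b∈ a≢b aa′ pna bb′ pnb others irrA irrB =
    acyclic (square
      (vertex-≢ ir irC (separated a∈
        (swap-avoids (swap-removes (edge⇒≢ G aa′)) a≢b′)))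
      (vertex-≢ irA irB (separated (swap-keeps b∈ (≢-sym a≢b)) (swap-removes (edge⇒≢ G bb′))))
      (edge ir irA (swap-IRAdj G a∈ aa′))
      (edge irA irC (swap-IRAdj G (swap-keeps b∈ (≢-sym a≢b)) bb′))
      (edge-sym T (edge irB irC (subst (IRAdj G (swap D b b′)) (swap-comm (≢-sym a′≢b) (≢-sym b′≢a))
        (swap-IRAdj G (swap-keeps a∈ a≢b) aa′))))
      (edge-sym T (edge ir irB (swap-IRAdj G b∈ bb′))))
    where
    a′∉D = external-PN G aa′ pna
    b′∉D = external-PN G bb′ pnb

    a≢b′ : a ≢ b′
    a≢b′ refl = b′∉D a∈

    b′≢a = ≢-sym a≢b′

    a′≢b : a′ ≢ b
    a′≢b refl = a′∉D b∈

    b′≢a′ : b′ ≢ a′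
    b′≢a′ refl = a≢b (≡-sym (PN-unique G b∈ pna bb′))

    irA = swap-IRSet G ir a′∉D irrA
    irB = swap-IRSet G ir b′∉D irrB
    irC = swap-IRSet G irA (swap-avoids b′∉D b′≢a′)
      (double-swap-irredundant G a∈ b∈ a≢b pna pnb others)

  -- An edge `x y` of `D` would be its only edge. All other vertices are then isolated in `D`, and
  -- exchanging `x` or `y` for a private neighbour leaves an independent set, so `no-private-square`
  -- applies.
  edges-within-pair⇒independent : ∀ {D} → IsIRSet G D → ∀ a b →
    (∀ {x y} → x ∈ D → y ∈ D → Edge G x y → x ≡ a ⊎ x ≡ b) → Independent G D
  edges-within-pair⇒independent {D} ir a b within {x} {y} x∈ y∈ xy =
    no-private-square ir x∈ y∈ (edge⇒≢ G xy) (PN-edge G y∈ xy pnx) pnx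
      (PN-edge G x∈ yx pny) pny
      (λ z∈ z≢x z≢y → isolated⇒self-PN G λ w∈ e → [ z≢x , z≢y ]′ (endpoint z∈ w∈ e))
      -- An edge of `D` avoiding `x` would have `y` at both ends.
      (independent⇒irredundant G (PN-swap-independent G (PN-edge G y∈ xy pnx) pnx
        λ z∈ w∈ z≢x w≢x e → edge⇒≢ G e (trans (other z∈ w∈ z≢x e)
          (≡-sym (other w∈ z∈ w≢x (edge-sym G e))))))
      (independent⇒irredundant G (PN-swap-independent G (PN-edge G x∈ yx pny) pny
        λ z∈ w∈ z≢y w≢y e → edge⇒≢ G e (trans (other′ z∈ w∈ z≢y e)
          (≡-sym (other′ w∈ z∈ w≢y (edge-sym G e))))))
    where
    yx = edge-sym G xy
    pnx = proj₂ (proj₁ ir x x∈)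
    pny = proj₂ (proj₁ ir y y∈)

    -- Applied to `x y` in both directions, `within` puts both ends in the pair `a`, `b`; being
    -- distinct, they exhaust it.
    endpoint : ∀ {z w} → z ∈ D → w ∈ D → Edge G z w → z ≡ x ⊎ z ≡ y
    endpoint z∈ w∈ e with within z∈ w∈ e | within x∈ y∈ xy | within y∈ x∈ yx
    ... | inj₁ refl | inj₁ refl | _         = inj₁ refl
    ... | inj₁ refl | inj₂ _    | inj₁ refl = inj₂ refl
    ... | inj₁ refl | inj₂ refl | inj₂ refl = contradiction refl (edge⇒≢ G xy)
    ... | inj₂ refl | inj₂ refl | _         = inj₁ refl
    ... | inj₂ refl | inj₁ _    | inj₂ refl = inj₂ refl
    ... | inj₂ refl | inj₁ refl | inj₁ refl = contradiction refl (edge⇒≢ G xy)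

    other : ∀ {z w} → z ∈ D → w ∈ D → z ≢ x → Edge G z w → z ≡ y
    other z∈ w∈ z≢x e = [ (λ z≡x → contradiction z≡x z≢x) , id ]′ (endpoint z∈ w∈ e)

    other′ : ∀ {z w} → z ∈ D → w ∈ D → z ≢ y → Edge G z w → z ≡ x
    other′ z∈ w∈ z≢y e = [ id , (λ z≡y → contradiction z≡y z≢y) ]′ (endpoint z∈ w∈ e)

  -- Let `A` be `B` with `v` exchanged for `u`, and `C` be `B` with `a` exchanged for `b`. If `v`
  -- and `a` differ, the exchanges commute and give a square. If they agree, then `A`, `B`, `C` form
  -- a triangle when `u b` is an edge, and otherwise `A` together with `b` is a larger independent
  -- set.
  no-independent-path : ∀ {A B C} → IsIRSet G A → IsIRSet G B → IsIRSet G C →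
    Independent G A → Independent G B → Independent G C →
    IRAdj G B A → IRAdj G B C → A ≢ C → ⊥
  no-independent-path {B = B} ia ib ic indA indB indC
    ba@(v , u , v∈ , u∈ , vu , refl) bc@(a , b , a∈ , b∈ , ab , refl) A≢C = compare (v ≟ a)
    where
    u∉B : u ∉ B
    u∉B u∈B = indB v∈ u∈B vu

    b∉B : b ∉ B
    b∉B b∈B = indB a∈ b∈B ab

    -- Independence of `B` keeps `w` out of `B`, and independence after the exchange keeps `w` from
    -- being adjacent to the vertices that remain.
    exchange-PN : ∀ {x w} → x ∈ B → Edge G x w → Independent G (swap B x w) → InPN G x B w
    exchange-PN x∈ xw ind = inj₂ xw , λ where
      z z∈ z≢x (inj₁ refl) → indB x∈ z∈ xw
      z z∈ z≢x (inj₂ zw)   → ind (swap-keeps z∈ z≢x) swap-adds zw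

    module _ (v≡a : v ≡ a) (¬ub : ¬ Edge G u b) where

      b∉A : b ∉ swap B v u
      b∉A = swap-avoids b∉B λ { refl → A≢C (cong (λ z → swap B z u) v≡a) }

      A∪b = swap B v u ∪ ⁅ b ⁆

      b-isolated : ∀ {x} → x ∈ swap B v u → ¬ Edge G x b
      b-isolated x∈A xb with ∈-swap⁻ x∈A
      ... | inj₂ refl        = ¬ub xb
      ... | inj₁ (x∈B , x≢v) =
        indC (swap-keeps x∈B (λ { refl → x≢v (≡-sym v≡a) })) swap-adds xb

      A∪b-independent : Independent G A∪b
      A∪b-independent x∈ y∈ e
        with x∈p∪q⁻ (swap B v u) ⁅ b ⁆ x∈ | x∈p∪q⁻ (swap B v u) ⁅ b ⁆ y∈
      ... | inj₁ x∈A | inj₁ y∈A = indA x∈A y∈A e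
      ... | inj₁ x∈A | inj₂ y∈b = b-isolated x∈A (subst (Edge G _) (x∈⁅y⁆⇒x≡y b y∈b) e)
      ... | inj₂ x∈b | inj₁ y∈A =
        b-isolated y∈A (edge-sym G (subst (λ z → Edge G z _) (x∈⁅y⁆⇒x≡y b x∈b) e))
      ... | inj₂ x∈b | inj₂ y∈b =
        edge⇒≢ G e (trans (x∈⁅y⁆⇒x≡y b x∈b) (≡-sym (x∈⁅y⁆⇒x≡y b y∈b)))

      A-not-maximum : ⊥
      A-not-maximum = <⇒≱
        (p⊂q⇒∣p∣<∣q∣ (p⊆p∪q ⁅ b ⁆ , b , x∈p∪q⁺ (inj₂ (x∈⁅x⁆ b)) , b∉A))
        (proj₂ ia A∪b (independent⇒irredundant G A∪b-independent))

    compare : Dec (v ≡ a) → ⊥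
    compare (no v≢a) = no-private-square ib v∈ a∈ v≢a vu (exchange-PN v∈ vu indA)
      ab (exchange-PN a∈ ab indC) (λ x∈ _ _ → isolated⇒self-PN G (indB x∈))
      (proj₁ ia) (proj₁ ic)
    compare (yes v≡a) with T? (adj G u b)
    ... | no ¬ub = A-not-maximum v≡a ¬ub
    ... | yes ub =
      acyclic (triangle (edge⇒≢ T BA) (edge⇒≢ T AC) (edge⇒≢ T BC) BA AC (edge-sym T BC))
      where
      BA = edge ib ia ba
      BC = edge ib ic bc
      AC = edge ia ic (subst (IRAdj G (swap B v u))
        (trans (swap-swap u∉B) (cong (λ z → swap B z b) v≡a)) (swap-IRAdj G swap-adds ub))

  -- Symmetry is borrowed from `T` through the isomorphism, which avoids computing the reverse swap.
  IRAdj-sym : ∀ {A B} → IsIRSet G A → IsIRSet G B → IRAdj G A B → IRAdj G B A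
  IRAdj-sym ia ib = subst₂ (IRAdj G) (f-vertex ib) (f-vertex ia) ∘ f-adj ∘ edge-sym T ∘ edge ia ib

  -- Three swaps from a dependent IR-set to its flip

  module ThreeSwaps {X : Subset n} (irX : IsIRSet G X) (dependent : ¬ Independent G X) where

    open Flip G (proj₁ irX)

    -- In other words, a dependent IR-set has at least three non-isolated vertices.
    nonisolated-not-covered : ∀ a b → ¬ (∀ {x} → x ∈ X → HasNbr x → x ≡ a ⊎ x ≡ b)
    nonisolated-not-covered a b cover = dependent
      (edges-within-pair⇒independent irX a b λ x∈ y∈ e → cover x∈ (_ , y∈ , e))

    module _ {u₁ v₁ u₂ v₂ u₃ v₃ : Fin n} (uv₁ : Edge G u₁ v₁) (uv₂ : Edge G u₂ v₂)
      (uv₃ : Edge G u₃ v₃)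
      (irW₁ : IsIRSet G (swap X u₁ v₁))
      (irW₂ : IsIRSet G (swap (swap X u₁ v₁) u₂ v₂))
      (irW₃ : IsIRSet G (swap (swap (swap X u₁ v₁) u₂ v₂) u₃ v₃))
      (image≡W₃ : image ≡ swap (swap (swap X u₁ v₁) u₂ v₂) u₃ v₃) where

      private
        W₁ W₂ W₃ : Subset n
        W₁ = swap X u₁ v₁
        W₂ = swap W₁ u₂ v₂
        W₃ = swap W₂ u₃ v₃

        -- A vertex other than the three `uᵢ` survives all swaps, whereas the flip contains no
        -- non-isolated vertex of `X`.
        removed : ∀ {x} → x ∈ X → HasNbr x → x ≡ u₁ ⊎ x ≡ u₂ ⊎ x ≡ u₃
        removed {x} x∈ has with x ≟ u₁ | x ≟ u₂ | x ≟ u₃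
        ... | yes eq | _      | _      = inj₁ eq
        ... | no _   | yes eq | _      = inj₂ (inj₁ eq)
        ... | no _   | no _   | yes eq = inj₂ (inj₂ eq)
        ... | no ≢₁  | no ≢₂  | no ≢₃  = contradiction
          (subst (x ∈_) (≡-sym image≡W₃) (swap-keeps (swap-keeps (swap-keeps x∈ ≢₁) ≢₂) ≢₃))
          (nonisolated∉image x∈ has)

        added : ∀ {w} → w ∈ W₃ → w ∉ X → w ≡ v₁ ⊎ w ≡ v₂ ⊎ w ≡ v₃
        added w∈ w∉ with ∈-swap⁻ w∈
        ... | inj₂ eq = inj₂ (inj₂ eq)
        ... | inj₁ (w∈₂ , _) with ∈-swap⁻ w∈₂
        ...   | inj₂ eq = inj₂ (inj₁ eq)
        ...   | inj₁ (w∈₁ , _) with ∈-swap⁻ w∈₁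
        ...     | inj₂ eq       = inj₁ eq
        ...     | inj₁ (w∈X , _) = contradiction w∈X w∉

        drop₁ : ∀ {x} → x ≢ u₁ → x ≡ u₁ ⊎ x ≡ u₂ ⊎ x ≡ u₃ → x ≡ u₂ ⊎ x ≡ u₃
        drop₁ ≢ = [ (λ eq → contradiction eq ≢) , id ]′

        drop₂ : ∀ {x} → x ≢ u₂ → x ≡ u₁ ⊎ x ≡ u₂ ⊎ x ≡ u₃ → x ≡ u₁ ⊎ x ≡ u₃
        drop₂ ≢ = [ inj₁ , [ (λ eq → contradiction eq ≢) , inj₂ ]′ ]′

        drop₃ : ∀ {x} → x ≢ u₃ → x ≡ u₁ ⊎ x ≡ u₂ ⊎ x ≡ u₃ → x ≡ u₁ ⊎ x ≡ u₂
        drop₃ ≢ = [ inj₁ , [ inj₂ , (λ eq → contradiction eq ≢) ]′ ]′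

        Nonisolated : Fin n → Set
        Nonisolated x = x ∈ X × HasNbr x

        nonisolated? : ∀ x → Dec (Nonisolated x)
        nonisolated? x = (x ∈? X) ×-dec hasNbr? x

        -- At least three non-isolated vertices have to be among `u₁`, `u₂`, `u₃`, so these are all
        -- non-isolated and, as shown below, pairwise distinct.
        nonisolated₁ : Nonisolated u₁
        nonisolated₁ with nonisolated? u₁
        ... | yes p = p
        ... | no ¬p = ⊥-elim (nonisolated-not-covered u₂ u₃ λ x∈ has →
          drop₁ (λ { refl → ¬p (x∈ , has) }) (removed x∈ has))

        nonisolated₂ : Nonisolated u₂
        nonisolated₂ with nonisolated? u₂
        ... | yes p = p
        ... | no ¬p = ⊥-elim (nonisolated-not-covered u₁ u₃ λ x∈ has →
          drop₂ (λ { refl → ¬p (x∈ , has) }) (removed x∈ has))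

        nonisolated₃ : Nonisolated u₃
        nonisolated₃ with nonisolated? u₃
        ... | yes p = p
        ... | no ¬p = ⊥-elim (nonisolated-not-covered u₁ u₂ λ x∈ has →
          drop₃ (λ { refl → ¬p (x∈ , has) }) (removed x∈ has))

        u₁∈X = proj₁ nonisolated₁
        u₂∈X = proj₁ nonisolated₂
        u₃∈X = proj₁ nonisolated₃

        u₁≢u₂ : u₁ ≢ u₂
        u₁≢u₂ refl = nonisolated-not-covered u₁ u₃ λ x∈ has →
          [ inj₁ , id ]′ (removed x∈ has)

        u₁≢u₃ : u₁ ≢ u₃
        u₁≢u₃ refl = nonisolated-not-covered u₁ u₂ λ x∈ has →
          [ inj₁ , [ inj₂ , inj₁ ]′ ]′ (removed x∈ has)

        u₂≢u₃ : u₂ ≢ u₃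
        u₂≢u₃ refl = nonisolated-not-covered u₁ u₂ λ x∈ has →
          [ inj₁ , [ inj₂ , inj₂ ]′ ]′ (removed x∈ has)

        φ-added : ∀ {u} → Nonisolated u → φ u ≡ v₁ ⊎ φ u ≡ v₂ ⊎ φ u ≡ v₃
        φ-added (u∈ , has) = added (subst (_ ∈_) image≡W₃ (φ∈image u∈))
          (external-PN G (φ-edge u∈ has) (φ-PN u∈))

        φ-target : ∀ {u x v} → u ∈ X → x ∈ X → Edge G x v → φ u ≡ v → x ≡ u
        φ-target u∈ x∈ xv refl = PN-unique G x∈ (φ-PN u∈) xv

        -- The vertex `φ u₁` is one of the `vⱼ`. It is adjacent to `uⱼ` in `X` and private to `u₁`,
        -- so `uⱼ` must be `u₁`.
        PN₁ : InPN G u₁ X v₁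
        PN₁ with φ-added nonisolated₁
        ... | inj₁ refl      = φ-PN u₁∈X
        ... | inj₂ (inj₁ eq) = ⊥-elim (u₁≢u₂ (≡-sym (φ-target u₁∈X u₂∈X uv₂ eq)))
        ... | inj₂ (inj₂ eq) = ⊥-elim (u₁≢u₃ (≡-sym (φ-target u₁∈X u₃∈X uv₃ eq)))

        PN₂ : InPN G u₂ X v₂
        PN₂ with φ-added nonisolated₂
        ... | inj₁ eq          = ⊥-elim (u₁≢u₂ (φ-target u₂∈X u₁∈X uv₁ eq))
        ... | inj₂ (inj₁ refl) = φ-PN u₂∈X
        ... | inj₂ (inj₂ eq)   = ⊥-elim (u₂≢u₃ (≡-sym (φ-target u₂∈X u₃∈X uv₃ eq)))

        PN₃ : InPN G u₃ X v₃
        PN₃ with φ-added nonisolated₃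
        ... | inj₁ eq          = ⊥-elim (u₁≢u₃ (φ-target u₃∈X u₁∈X uv₁ eq))
        ... | inj₂ (inj₁ eq)   = ⊥-elim (u₂≢u₃ (φ-target u₃∈X u₂∈X uv₂ eq))
        ... | inj₂ (inj₂ refl) = φ-PN u₃∈X

        v₁∉X = external-PN G uv₁ PN₁
        v₂∉X = external-PN G uv₂ PN₂
        v₃∉X = external-PN G uv₃ PN₃

        ∈∉⇒≢ : ∀ {x y} → x ∈ X → y ∉ X → x ≢ y
        ∈∉⇒≢ x∈ y∉ refl = y∉ x∈

        v₁≢v₂ : v₁ ≢ v₂
        v₁≢v₂ refl = u₁≢u₂ (PN-unique G u₁∈X PN₂ uv₁)

        v₁≢v₃ : v₁ ≢ v₃
        v₁≢v₃ refl = u₁≢u₃ (PN-unique G u₁∈X PN₃ uv₁)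

        v₂≢v₃ : v₂ ≢ v₃
        v₂≢v₃ refl = u₂≢u₃ (PN-unique G u₂∈X PN₃ uv₂)

        u₂∈W₁ : u₂ ∈ W₁
        u₂∈W₁ = swap-keeps u₂∈X (≢-sym u₁≢u₂)

        u₃∈W₁ : u₃ ∈ W₁
        u₃∈W₁ = swap-keeps u₃∈X (≢-sym u₁≢u₃)

        u₃∈W₂ : u₃ ∈ W₂
        u₃∈W₂ = swap-keeps u₃∈W₁ (≢-sym u₂≢u₃)

        v₁∈W₂ : v₁ ∈ W₂
        v₁∈W₂ = swap-keeps swap-adds (≢-sym (∈∉⇒≢ u₂∈X v₁∉X))

        -- Within `X` the vertex `v₁` is adjacent only to `u₁`, which is gone; the remaining edges
        -- join `u₂` and `u₃`.
        W₁-independent : Independent G W₁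
        W₁-independent = edges-within-pair⇒independent irW₁ u₂ u₃ within
          where
          within : ∀ {x y} → x ∈ W₁ → y ∈ W₁ → Edge G x y → x ≡ u₂ ⊎ x ≡ u₃
          within x∈ y∈ e with ∈-swap⁻ x∈ | ∈-swap⁻ y∈
          ... | inj₁ (x∈X , x≢u₁) | inj₁ (y∈X , _) = drop₁ x≢u₁ (removed x∈X (_ , y∈X , e))
          ... | inj₁ (x∈X , x≢u₁) | inj₂ refl = ⊥-elim (x≢u₁ (PN-unique G x∈X PN₁ e))
          ... | inj₂ refl | inj₁ (y∈X , y≢u₁) =
            ⊥-elim (y≢u₁ (PN-unique G y∈X PN₁ (edge-sym G e)))
          ... | inj₂ refl | inj₂ refl = ⊥-elim (edge-irrefl G e)

        -- Since `W₁` is independent, every edge here has `v₂` as an end, and the only other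
        -- possible end is `v₁`.
        W₂-independent : Independent G W₂
        W₂-independent = edges-within-pair⇒independent irW₂ v₁ v₂ within
          where
          within : ∀ {x y} → x ∈ W₂ → y ∈ W₂ → Edge G x y → x ≡ v₁ ⊎ x ≡ v₂
          within x∈ y∈ e with ∈-swap⁻ x∈
          ... | inj₂ eq = inj₂ eq
          ... | inj₁ (x∈₁ , x≢u₂) with ∈-swap⁻ x∈₁ | ∈-swap⁻ y∈
          ...   | inj₂ eq        | _              = inj₁ eq
          ...   | inj₁ _         | inj₁ (y∈₁ , _) = ⊥-elim (W₁-independent x∈₁ y∈₁ e)
          ...   | inj₁ (x∈X , _) | inj₂ refl      = ⊥-elim (x≢u₂ (PN-unique G x∈X PN₂ e))

        W₃-edge : ∀ {x y} → x ∈ W₃ → y ∈ W₃ → Edge G x y →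
          x ≡ v₃ ⊎ (x ≡ v₁ × Edge G v₁ v₃) ⊎ (x ≡ v₂ × Edge G v₂ v₃)
        W₃-edge x∈ y∈ e with ∈-swap⁻ x∈
        ... | inj₂ eq = inj₁ eq
        ... | inj₁ (x∈₂ , x≢u₃) with ∈-swap⁻ y∈
        ...   | inj₁ (y∈₂ , _) = ⊥-elim (W₂-independent x∈₂ y∈₂ e)
        ...   | inj₂ refl with ∈-swap⁻ x∈₂
        ...     | inj₂ refl      = inj₂ (inj₂ (refl , e))
        ...     | inj₁ (x∈₁ , _) with ∈-swap⁻ x∈₁
        ...       | inj₂ refl      = inj₂ (inj₁ (refl , e))
        ...       | inj₁ (x∈X , _) = ⊥-elim (x≢u₃ (PN-unique G x∈X PN₃ e))

        u₂∉W₂ : u₂ ∉ W₂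
        u₂∉W₂ = swap-removes (edge⇒≢ G uv₂)

        u₂∉W₃ : u₂ ∉ W₃
        u₂∉W₃ = swap-avoids u₂∉W₂ (∈∉⇒≢ u₂∈X v₃∉X)

        -- Otherwise `W₁`, `W₂`, `W₃` would be a path of independent IR-sets.
        W₃-dependent : ¬ Independent G W₃
        W₃-dependent ind = no-independent-path irW₁ irW₂ irW₃ W₁-independent W₂-independent ind
          (IRAdj-sym irW₁ irW₂ (swap-IRAdj G u₂∈W₁ uv₂)) (swap-IRAdj G u₃∈W₂ uv₃)
          (separated u₂∈W₁ u₂∉W₃)

        -- Every edge of `W₃` joins `v₃` to `v₁` or `v₂`. Without `v₁ v₃`, all edges would lie
        -- within one pair and `W₃` would be independent.
        v₁v₃ : Edge G v₁ v₃
        v₁v₃ with T? (adj G v₁ v₃)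
        ... | yes e = e
        ... | no ¬e = ⊥-elim (W₃-dependent (edges-within-pair⇒independent irW₃ v₂ v₃
          λ x∈ y∈ e → [ inj₂ , [ (λ (_ , e) → contradiction e ¬e) , inj₁ ∘ proj₁ ]′ ]′
            (W₃-edge x∈ y∈ e)))

        -- A neighbour of `u₃` in `X` is `u₁` or `u₂`, and `u₂` and `u₃` lie together in the
        -- independent set `W₁`.
        u₁u₃ : Edge G u₁ u₃
        u₁u₃ with proj₂ nonisolated₃
        ... | y , y∈ , e with removed y∈ (_ , u₃∈X , edge-sym G e)
        ...   | inj₁ refl        = edge-sym G e
        ...   | inj₂ (inj₁ refl) = ⊥-elim (W₁-independent u₃∈W₁ u₂∈W₁ e)
        ...   | inj₂ (inj₂ refl) = ⊥-elim (edge-irrefl G e)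

        -- In terms of `X`: `Q` is `X - u₃` with `v₁` added, and `Q′` is `X - u₁ - u₂` with `v₂` and
        -- `v₃` added. The edges `u₁ u₃` and `v₁ v₃` make them neighbours of `W₁` and `W₂`.
        Q Q′ : Subset n
        Q  = swap W₁ u₃ u₁
        Q′ = swap W₂ v₁ v₃


        -- Private neighbours: `u₃` for `u₁`, `v₃` for `v₁`, `v₂` for `u₂`; every other vertex is
        -- isolated in `Q` and serves itself.
        Q-irredundant : Irredundant G Q
        Q-irredundant x x∈ with ∈-swap⁻ x∈
        ... | inj₂ refl = u₃ , inj₂ u₁u₃ , exclusive
          where
          exclusive : ∀ z → z ∈ Q → z ≢ u₁ → ¬ InClosedNbr G z u₃
          exclusive z z∈ z≢u₁ near with ∈-swap⁻ z∈ | near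
          ... | inj₂ z≡u₁        | _         = z≢u₁ z≡u₁
          ... | inj₁ (_ , z≢u₃)  | inj₁ refl = z≢u₃ refl
          ... | inj₁ (z∈W₁ , _)  | inj₂ e    = W₁-independent z∈W₁ u₃∈W₁ e
        ... | inj₁ (x∈W₁ , x≢u₃) with ∈-swap⁻ x∈W₁
        ...   | inj₂ refl = v₃ , inj₂ v₁v₃ , exclusive
          where
          exclusive : ∀ z → z ∈ Q → z ≢ v₁ → ¬ InClosedNbr G z v₃
          exclusive z z∈ z≢v₁ with ∈-swap⁻ z∈
          ... | inj₂ refl = proj₂ PN₃ z u₁∈X u₁≢u₃
          ... | inj₁ (z∈W₁ , z≢u₃) with ∈-swap⁻ z∈W₁
          ...   | inj₂ z≡v₁      = contradiction z≡v₁ z≢v₁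
          ...   | inj₁ (z∈X , _) = proj₂ PN₃ z z∈X z≢u₃
        ...   | inj₁ (x∈X , x≢u₁) with x ≟ u₂
        ...     | yes refl = v₂ , inj₂ uv₂ , exclusive
          where
          exclusive : ∀ z → z ∈ Q → z ≢ u₂ → ¬ InClosedNbr G z v₂
          exclusive z z∈ z≢u₂ near with ∈-swap⁻ z∈
          ... | inj₂ refl = proj₂ PN₂ z u₁∈X z≢u₂ near
          ... | inj₁ (z∈W₁ , _) with ∈-swap⁻ z∈W₁ | near
          ...   | inj₁ (z∈X , _) | _         = proj₂ PN₂ z z∈X z≢u₂ near
          ...   | inj₂ refl      | inj₁ v₂≡v₁ = v₁≢v₂ (≡-sym v₂≡v₁)
          ...   | inj₂ refl      | inj₂ e    = W₂-independent v₁∈W₂ swap-adds e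
        ...     | no x≢u₂ = x , isolated⇒self-PN G isolated
          where
          isolated : ∀ {y} → y ∈ Q → ¬ Edge G x y
          isolated y∈ e with ∈-swap⁻ y∈
          ... | inj₁ (y∈W₁ , _) = W₁-independent x∈W₁ y∈W₁ e
          ... | inj₂ refl = [ x≢u₁ , [ x≢u₂ , x≢u₃ ]′ ]′ (removed x∈X (_ , u₁∈X , e))

        -- Private neighbours: `v₁` for `v₃`, `u₂` for `v₂`, `u₁` for `u₃`; every other vertex is
        -- isolated in `Q′` and serves itself.
        Q′-irredundant : Irredundant G Q′
        Q′-irredundant x x∈ with ∈-swap⁻ x∈
        ... | inj₂ refl = v₁ , inj₂ (edge-sym G v₁v₃) , exclusive
          where
          exclusive : ∀ z → z ∈ Q′ → z ≢ v₃ → ¬ InClosedNbr G z v₁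
          exclusive z z∈ z≢v₃ near with ∈-swap⁻ z∈ | near
          ... | inj₂ z≡v₃        | _         = z≢v₃ z≡v₃
          ... | inj₁ (_ , z≢v₁)  | inj₁ refl = z≢v₁ refl
          ... | inj₁ (z∈W₂ , _)  | inj₂ e    = W₂-independent z∈W₂ v₁∈W₂ e
        ... | inj₁ (x∈W₂ , x≢v₁) with ∈-swap⁻ x∈W₂
        ...   | inj₂ refl = u₂ , inj₂ (edge-sym G uv₂) , exclusive
          where
          exclusive : ∀ z → z ∈ Q′ → z ≢ v₂ → ¬ InClosedNbr G z u₂
          exclusive z z∈ z≢v₂ near with ∈-swap⁻ z∈
          ... | inj₂ refl = proj₂ PN₃ u₂ u₂∈X u₂≢u₃ (closedNbr-sym G near)
          ... | inj₁ (z∈W₂ , _) with ∈-swap⁻ z∈W₂ | near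
          ...   | inj₂ z≡v₂         | _         = z≢v₂ z≡v₂
          ...   | inj₁ (_ , z≢u₂)   | inj₁ refl = z≢u₂ refl
          ...   | inj₁ (z∈W₁ , _)   | inj₂ e    = W₁-independent z∈W₁ u₂∈W₁ e
        ...   | inj₁ (x∈W₁ , x≢u₂) with ∈-swap⁻ x∈W₁
        ...     | inj₂ x≡v₁ = contradiction x≡v₁ x≢v₁
        ...     | inj₁ (x∈X , x≢u₁) with x ≟ u₃
        ...       | yes refl = u₁ , inj₂ (edge-sym G u₁u₃) , exclusive
          where
          exclusive : ∀ z → z ∈ Q′ → z ≢ u₃ → ¬ InClosedNbr G z u₁
          exclusive z z∈ z≢u₃ near with ∈-swap⁻ z∈
          ... | inj₂ refl = proj₂ PN₃ u₁ u₁∈X u₁≢u₃ (closedNbr-sym G near)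
          ... | inj₁ (z∈W₂ , z≢v₁) with ∈-swap⁻ z∈W₂
          ...   | inj₂ refl = proj₂ PN₂ u₁ u₁∈X u₁≢u₂ (closedNbr-sym G near)
          ...   | inj₁ (z∈W₁ , z≢u₂) with ∈-swap⁻ z∈W₁ | near
          ...     | inj₂ z≡v₁         | _         = z≢v₁ z≡v₁
          ...     | inj₁ (_ , z≢u₁)   | inj₁ refl = z≢u₁ refl
          ...     | inj₁ (z∈X , z≢u₁) | inj₂ e    =
            [ z≢u₁ , [ z≢u₂ , z≢u₃ ]′ ]′ (removed z∈X (_ , u₁∈X , e))
        ...       | no x≢u₃ = x , isolated⇒self-PN G isolated
          where
          isolated : ∀ {y} → y ∈ Q′ → ¬ Edge G x y
          isolated y∈ e with ∈-swap⁻ y∈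
          ... | inj₁ (y∈W₂ , _) = W₂-independent x∈W₂ y∈W₂ e
          ... | inj₂ refl       = x≢u₃ (PN-unique G x∈X PN₃ e)

        u₁∉W₁ : u₁ ∉ W₁
        u₁∉W₁ = swap-removes (edge⇒≢ G uv₁)

        u₁∉W₂ : u₁ ∉ W₂
        u₁∉W₂ = swap-avoids u₁∉W₁ (∈∉⇒≢ u₁∈X v₂∉X)

        u₁∉W₃ : u₁ ∉ W₃
        u₁∉W₃ = swap-avoids u₁∉W₂ (∈∉⇒≢ u₁∈X v₃∉X)

        u₁∉Q′ : u₁ ∉ Q′
        u₁∉Q′ = swap-avoids u₁∉W₂ (∈∉⇒≢ u₁∈X v₃∉X)

        u₂∉Q′ : u₂ ∉ Q′
        u₂∉Q′ = swap-avoids u₂∉W₂ (∈∉⇒≢ u₂∈X v₃∉X)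

        u₃∉Q : u₃ ∉ Q
        u₃∉Q = swap-removes (≢-sym u₁≢u₃)

        u₃∉W₃ : u₃ ∉ W₃
        u₃∉W₃ = swap-removes (edge⇒≢ G uv₃)

        v₁∈W₃ : v₁ ∈ W₃
        v₁∈W₃ = swap-keeps v₁∈W₂ (≢-sym (∈∉⇒≢ u₃∈X v₁∉X))

        v₁∉Q′ : v₁ ∉ Q′
        v₁∉Q′ = swap-removes v₁≢v₃

        v₃∉W₂ : v₃ ∉ W₂
        v₃∉W₂ = swap-avoids (swap-avoids v₃∉X (≢-sym v₁≢v₃)) (≢-sym v₂≢v₃)

        irQ : IsIRSet G Q
        irQ = swap-IRSet G irW₁ u₁∉W₁ Q-irredundant

        irQ′ : IsIRSet G Q′
        irQ′ = swap-IRSet G irW₂ v₃∉W₂ Q′-irredundant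

      -- The centres are `W₁` and `W₂`; `X` and `Q` hang at `W₁`, `W₃` and `Q′` at `W₂`. Each two of
      -- the six sets are told apart by one of `u₁`, `u₂`, `u₃`, `v₁`.
      three-swaps⇒doubleStar : DoubleStar T
      three-swaps⇒doubleStar = doubleStar
        ( (vertex-≢ irW₁ irW₂ (separated u₂∈W₁ u₂∉W₂)
        ∷ ≢-sym (vertex-≢ irX irW₁ (separated u₁∈X u₁∉W₁))
        ∷ ≢-sym (vertex-≢ irQ irW₁ (separated swap-adds u₁∉W₁))
        ∷ vertex-≢ irW₁ irW₃ (separated u₂∈W₁ u₂∉W₃)
        ∷ vertex-≢ irW₁ irQ′ (separated u₂∈W₁ u₂∉Q′)
        ∷ [])
        ∷ (≢-sym (vertex-≢ irX irW₂ (separated u₁∈X u₁∉W₂))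
        ∷ ≢-sym (vertex-≢ irQ irW₂ (separated swap-adds u₁∉W₂))
        ∷ vertex-≢ irW₂ irW₃ (separated u₃∈W₂ u₃∉W₃)
        ∷ vertex-≢ irW₂ irQ′ (separated v₁∈W₂ v₁∉Q′)
        ∷ [])
        ∷ (vertex-≢ irX irQ (separated u₃∈X u₃∉Q)
        ∷ vertex-≢ irX irW₃ (separated u₁∈X u₁∉W₃)
        ∷ vertex-≢ irX irQ′ (separated u₁∈X u₁∉Q′)
        ∷ [])
        ∷ (vertex-≢ irQ irW₃ (separated swap-adds u₁∉W₃)
        ∷ vertex-≢ irQ irQ′ (separated swap-adds u₁∉Q′)
        ∷ [])
        ∷ (vertex-≢ irW₃ irQ′ (separated v₁∈W₃ v₁∉Q′) ∷ [])
        ∷ [] ∷ [])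
        (edge irW₁ irW₂ (swap-IRAdj G u₂∈W₁ uv₂))
        (edge-sym T (edge irX irW₁ (swap-IRAdj G u₁∈X uv₁)))
        (edge irW₁ irQ (swap-IRAdj G u₃∈W₁ (edge-sym G u₁u₃)))
        (edge irW₂ irW₃ (swap-IRAdj G u₃∈W₂ uv₃))
        (edge irW₂ irQ′ (swap-IRAdj G v₁∈W₂ v₁v₃))

  -- Walks from a dependent IR-set to its flip

  module _ {X : Subset n} (irX : IsIRSet G X) (dependent : ¬ Independent G X) where
    open Flip G (proj₁ irX)
    open ThreeSwaps irX dependent

    private
      removes : ∀ {A B} → IRAdj G A B → ∃[ u ] (∀ {x} → x ∈ A → x ≡ u ⊎ x ∈ B)
      removes {A} {B} (u , v , _ , _ , _ , refl) = u , keep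
        where
        keep : ∀ {x} → x ∈ A → x ≡ u ⊎ x ∈ B
        keep {x} x∈ with x ≟ u
        ... | yes eq = inj₁ eq
        ... | no ≢u  = inj₂ (swap-keeps x∈ ≢u)

    -- Each swap removes at most one vertex, but at least three have to go; the same count rules out
    -- two swaps.
    no-single-swap : ¬ IRAdj G X image
    no-single-swap xi = let u , keep = removes xi in
      nonisolated-not-covered u u λ x∈ has →
        [ inj₁ , ⊥-elim ∘ nonisolated∉image x∈ has ]′ (keep x∈)

    no-double-swap : ∀ {A} → IRAdj G X A → ¬ IRAdj G A image
    no-double-swap xa ai = let u , keep = removes xa ; v , keep′ = removes ai in
      nonisolated-not-covered u v λ x∈ has →
        [ inj₁ , [ inj₂ , ⊥-elim ∘ nonisolated∉image x∈ has ]′ ∘ keep′ ]′ (keep x∈)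

    triple-swap : ∀ {A B C} → IsIRSet G A → IsIRSet G B → IsIRSet G C → image ≡ C →
      IRAdj G X A → IRAdj G A B → IRAdj G B C → DoubleStar T
    triple-swap irA irB irC image≡C (_ , _ , _ , _ , e₁ , refl)
      (_ , _ , _ , _ , e₂ , refl) (_ , _ , _ , _ , e₃ , refl) =
      three-swaps⇒doubleStar e₁ e₂ e₃ irA irB irC image≡C

  dependent⇒doubleStar : ∀ i → ¬ Independent G (f i) →
    (∀ j → ∃[ k ] (k ≤ 3 × Walk T i j k)) → DoubleStar T
  dependent⇒doubleStar i dependent near =
    let j , fj≡image = f-onto image (image-IRSet (f-IRSet i)) in
    walk fj≡image (near j)
    where
    open Flip G (proj₁ (f-IRSet i))

    walk : ∀ {j} → f j ≡ image → ∃[ k ] (k ≤ 3 × Walk T i j k) → DoubleStar T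
    walk fj≡image (_ , _ , nil) = ⊥-elim (dependent λ x∈ y∈ e →
      nonisolated∉image x∈ (_ , y∈ , e) (subst (_ ∈_) fj≡image x∈))
    walk fj≡image (_ , _ , cons a nil) =
      ⊥-elim (no-single-swap (f-IRSet i) dependent (subst (IRAdj G (f i)) fj≡image (f-adj a)))
    walk fj≡image (_ , _ , cons a (cons b nil)) =
      ⊥-elim (no-double-swap (f-IRSet i) dependent (f-adj a) (subst (IRAdj G _) fj≡image (f-adj b)))
    walk fj≡image (_ , _ , cons a (cons b (cons c nil))) =
      triple-swap (f-IRSet i) dependent (f-IRSet _) (f-IRSet _) (f-IRSet _) (≡-sym fj≡image)
        (f-adj a) (f-adj b) (f-adj c)
    walk _ (_ , s≤s (s≤s (s≤s ())) , cons _ (cons _ (cons _ (cons _ _))))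

  -- Each inner vertex of a diametral path has two distinct neighbours on it, so
  -- `branching-eccentricity` brings all vertices within distance 3, as `dependent⇒doubleStar` asks.
  diameter-4⇒doubleStar : HasDiameter T 4 → DoubleStar T
  diameter-4⇒doubleStar (short , u , v , far) = path (short u v)
    where
    path : ∃[ k ] (k ≤ 4 × Walk T u v k) → DoubleStar T
    path (_ , _ , nil)          = contradiction (far _ nil) λ ()
    path (_ , _ , cons a nil)   = contradiction (far _ (cons a nil)) λ { (s≤s ()) }
    path (_ , _ , cons a (cons b nil)) =
      contradiction (far _ (cons a (cons b nil))) λ { (s≤s (s≤s ())) }
    path (_ , _ , cons a (cons b (cons c nil))) =
      contradiction (far _ (cons a (cons b (cons c nil)))) λ { (s≤s (s≤s (s≤s ()))) }
    path (_ , _ , cons {w = x} a (cons {w = y} b (cons {w = z} c (cons d nil)))) =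
      choose (independent? G (f x)) (independent? G (f y)) (independent? G (f z))
      where
      -- Any of these coincidences would leave a walk of length 2 from `u` to `v`.
      u≢y : u ≢ y
      u≢y refl = contradiction (far _ (cons c (cons d nil))) λ { (s≤s (s≤s ())) }

      x≢z : x ≢ z
      x≢z refl = contradiction (far _ (cons a (cons d nil))) λ { (s≤s (s≤s ())) }

      y≢v : y ≢ v
      y≢v refl = contradiction (far _ (cons a (cons b nil))) λ { (s≤s (s≤s ())) }

      Dependent : Subset n → Set
      Dependent D = ∃[ x ] ∃[ y ] (x ∈ D × y ∈ D × Edge G x y)

      from : ∀ i {p q} → p ≢ q → Edge T i p → Edge T i q → Dependent (f i) → DoubleStar T
      from i p≢q ip iq (_ , _ , x∈ , y∈ , e) = dependent⇒doubleStar i (λ ind → ind x∈ y∈ e)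
        (branching-eccentricity acyclic short p≢q ip iq)

      choose : Independent G (f x) ⊎ Dependent (f x) → Independent G (f y) ⊎ Dependent (f y) →
        Independent G (f z) ⊎ Dependent (f z) → DoubleStar T
      choose (inj₂ dep) _ _ = from x u≢y (edge-sym T a) b dep
      choose _ (inj₂ dep) _ = from y x≢z (edge-sym T b) c dep
      choose _ _ (inj₂ dep) = from z y≢v (edge-sym T c) d dep
      choose (inj₁ ix) (inj₁ iy) (inj₁ iz) = ⊥-elim
        (no-independent-path (f-IRSet x) (f-IRSet y) (f-IRSet z) ix iy iz
          (f-adj (edge-sym T b)) (f-adj c) (x≢z ∘ f-injective x z))
    path (_ , s≤s (s≤s (s≤s (s≤s ()))) , cons _ (cons _ (cons _ (cons _ (cons _ _)))))

-- Trees containing S(2,2)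

_++ʷ_ : ∀ {n} {G : Graph n} {u v w k l} → Walk G u v k → Walk G v w l → Walk G u w (k + l)
nil      ++ʷ q = q
cons e p ++ʷ q = cons e (p ++ʷ q)

extend : ∀ {k m} → Fin m → (Fin k → Fin m) → Fin (suc k) → Fin m
extend y σ zero    = y
extend y σ (suc i) = σ i

extend-injective : ∀ {k m} {y : Fin m} {σ : Fin k → Fin m} → (∀ i j → σ i ≡ σ j → i ≡ j) →
  (∀ i → σ i ≢ y) → ∀ i j → extend y σ i ≡ extend y σ j → i ≡ j
extend-injective inj new zero    zero    _  = refl
extend-injective inj new zero    (suc j) eq = contradiction (≡-sym eq) (new j)
extend-injective inj new (suc i) zero    eq = contradiction eq (new i)
extend-injective inj new (suc i) (suc j) eq = cong suc (inj i j eq)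

module _ {k m} (σ : Fin k → Fin m) (σ-injective : ∀ i j → σ i ≡ σ j → i ≡ j) (m≤k : m ≤ k) where

  -- A missed `y` could be added as a further value, giving an injection from a larger set.
  injective⇒onto : ∀ y → ∃[ i ] σ i ≡ y
  injective⇒onto y with any? (λ i → σ i ≟ y)
  ... | yes p = p
  ... | no ¬p = contradiction
    (injective⇒≤ λ {i} {j} → extend-injective σ-injective (λ i eq → ¬p (i , eq)) i j)
    (<⇒≱ (s≤s m≤k))

T-ext : ∀ {a b} → (T a → T b) → (T b → T a) → a ≡ b
T-ext {false} {false} f g = refl
T-ext {false} {true}  f g = ⊥-elim (g tt)
T-ext {true}  {false} f g = ⊥-elim (f tt)
T-ext {true}  {true}  f g = refl

module _ {m n} {G : Graph n} {S : Graph m} (connected : Connected S) (acyclic : Acyclic G)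
  (σ : Fin m → Fin n) (σ-injective : ∀ i j → σ i ≡ σ j → i ≡ j)
  (σ-hom : ∀ {i j} → Edge S i j → Edge G (σ i) (σ j)) (n≤m : n ≤ m) where

  spanning-copy⇒isomorphic : Isomorphic G S
  spanning-copy⇒isomorphic =
    mk↔ₛ′ σ⁻¹ σ (λ i → σ-injective _ i (proj₂ (onto (σ i)))) (λ y → proj₂ (onto y)) ,
    λ u v → T-ext
      (hom-reflects-edges S G σ σ-injective σ-hom connected acyclic ∘
        subst₂ (Edge G) (≡-sym (proj₂ (onto u))) (≡-sym (proj₂ (onto v))))
      (subst₂ (Edge G) (proj₂ (onto u)) (proj₂ (onto v)) ∘ σ-hom)
    where
    onto = injective⇒onto σ σ-injective n≤m
    σ⁻¹ : Fin n → Fin m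
    σ⁻¹ y = proj₁ (onto y)

-- The tree Sp(1,1;1,2): diameter, acyclicity and recognition

within? : ∀ {n} (G : Graph n) k u v → Dec (∃[ l ] (l ≤ k × Walk G u v l))
within? G zero u v with u ≟ v
... | yes refl = yes (0 , z≤n , nil)
... | no u≢v   = no λ { (_ , z≤n , nil) → u≢v refl }
within? G (suc k) u v = map′
  [ (λ { refl → 0 , z≤n , nil }) , (λ (_ , e , l , l≤k , p) → suc l , s≤s l≤k , cons e p) ]′
  (λ { (_ , _ , nil) → inj₁ refl
     ; (_ , s≤s l≤k , cons e p) → inj₂ (_ , e , _ , l≤k , p) })
  ((u ≟ v) ⊎-dec any? (λ w → T? (adj G u w) ×-dec within? G k w v))

Sp-diameter : HasDiameter Sp11-12 4
Sp-diameter =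
  toWitness {a? = all? λ u → all? λ v → within? Sp11-12 4 u v} tt ,
  -- The ends of the path 6, 5, 1, 0, 2: the tip of the long leg and a leaf at the opposite centre.
  # 6 , # 2 , λ k p → ℕ.≰⇒> λ k≤3 →
    toWitnessFalse {a? = within? Sp11-12 3 (# 6) (# 2)} tt (k , k≤3 , p)

Sp-connected : Connected Sp11-12
Sp-connected u v = let k , _ , p = proj₁ Sp-diameter u v in k , p

module _ {n} {G : Graph n} (cycle : Cycle G) where
  open Cycle cycle

  cycle-neighbours : ∀ i → ∃[ j ] ∃[ k ] (j ≢ k × Edge G (c i) (c j) × Edge G (c i) (c k))
  cycle-neighbours zero = suc zero , fromℕ _ , (λ ()) , steps zero , edge-sym G close
  cycle-neighbours (suc i) with view i
  ... | ‵fromℕ     = inject₁ i , zero , (λ ()) , edge-sym G (steps i) , close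
  ... | ‵inject₁ j = inject₁ i , suc (suc j) , distinct j , edge-sym G (steps i) , steps (suc j)
    where
    distinct : ∀ {n} (j : Fin n) → inject₁ (inject₁ j) ≢ suc (suc j)
    distinct j eq = ℕ.m≢1+n+m (toℕ j) {1}
      (trans (≡-sym (trans (toℕ-inject₁ (inject₁ j)) (toℕ-inject₁ j))) (cong toℕ eq))

module _ {n} (G : Graph n) where

  LeafOutside : Subset n → Fin n → Set
  LeafOutside E x = ∀ y z → y ∉ E → z ∉ E → Edge G x y → Edge G x z → y ≡ z

  -- A decidable certificate of acyclicity: `E` collects the vertices already deleted, and each
  -- listed vertex has at most one neighbour among those left.
  PeelingOrder : Subset n → List (Fin n) → Set
  PeelingOrder E []       = ∀ x → x ∈ E
  PeelingOrder E (x ∷ xs) = LeafOutside E x × PeelingOrder (E ∪ ⁅ x ⁆) xs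

  peelingOrder? : ∀ E xs → Dec (PeelingOrder E xs)
  peelingOrder? E []       = all? (λ x → x ∈? E)
  peelingOrder? E (x ∷ xs) =
    all? (λ y → all? λ z → ¬? (y ∈? E) →-dec ¬? (z ∈? E) →-dec
      T? (adj G x y) →-dec T? (adj G x z) →-dec (y ≟ z))
    ×-dec peelingOrder? (E ∪ ⁅ x ⁆) xs

  -- A cycle avoiding E avoids every vertex with at most one neighbour outside E.
  peelingOrder⇒acyclic : ∀ E xs → PeelingOrder E xs → (cycle : Cycle G) →
    ¬ (∀ i → Cycle.c cycle i ∉ E)
  peelingOrder⇒acyclic E []       all∈E         cycle off = off zero (all∈E _)
  peelingOrder⇒acyclic E (x ∷ xs) (leaf , rest) cycle off =
    peelingOrder⇒acyclic (E ∪ ⁅ x ⁆) xs rest cycle λ i →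
      [ off i , c≢x i ∘ x∈⁅y⁆⇒x≡y x ]′ ∘ x∈p∪q⁻ E ⁅ x ⁆
    where
    open Cycle cycle
    c≢x : ∀ i → c i ≢ x
    c≢x i refl = let j , k , j≢k , ij , ik = cycle-neighbours cycle i in
      j≢k (inj j k (leaf (c j) (c k) (off j) (off k) ij ik))

Sp-peeling : List (Fin 7)
Sp-peeling = # 2 ∷ # 3 ∷ # 4 ∷ # 6 ∷ # 5 ∷ # 0 ∷ # 1 ∷ []

Sp-acyclic : Acyclic Sp11-12
Sp-acyclic cycle = peelingOrder⇒acyclic Sp11-12 ∅ Sp-peeling
  (toWitness {a? = peelingOrder? Sp11-12 ∅ Sp-peeling} tt) cycle (λ _ → ∉⊥)

spEdges : List (Fin 7 × Fin 7)
spEdges = (# 0 , # 1) ∷ (# 0 , # 2) ∷ (# 0 , # 3) ∷ (# 1 , # 4) ∷ (# 1 , # 5) ∷ (# 5 , # 6) ∷ []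

spEdges-complete : ∀ u v → T (spE u v) → Any.Any ((u , v) ≡_) spEdges
spEdges-complete = toWitness {a? = all? λ u → all? λ v →
  T? (spE u v) →-dec Any.any? (Product.≡-dec _≟_ _≟_ (u , v)) spEdges} tt

module _ {m} {H : Graph m} (acyclic : Acyclic H) (m≤7 : m ≤ 7) (σ : Fin 7 → Fin m)
  (σ-injective : ∀ i j → σ i ≡ σ j → i ≡ j) where

  Sp-copy⇒isomorphic : All.All (λ (i , j) → Edge H (σ i) (σ j)) spEdges → Isomorphic H Sp11-12
  Sp-copy⇒isomorphic edges = spanning-copy⇒isomorphic Sp-connected acyclic σ σ-injective hom m≤7
    where
    one-way : ∀ {i j} → T (spE i j) → Edge H (σ i) (σ j)
    one-way e = All.lookup edges (spEdges-complete _ _ e)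

    hom : ∀ {i j} → Edge Sp11-12 i j → Edge H (σ i) (σ j)
    hom = [ one-way , edge-sym H ∘ one-way ]′ ∘ Equivalence.to T-∨

-- The seventh vertex of a tree of diameter 4 containing S(2,2)

module _ {m} {H : Graph m} (tree : IsTree H) (diameter : HasDiameter H 4)
  (star : DoubleStar H) where

  open DoubleStar star

  private
    vertices : Vec (Fin m) 6
    vertices = c ∷ d ∷ p ∷ q ∷ r ∷ s ∷ []

    σ₆ : Fin 6 → Fin m
    σ₆ = lookup vertices

    Near : Fin m → Set
    Near x = ∃[ h ] ((h ≡ c ⊎ h ≡ d) × (x ≡ h ⊎ Edge H x h))

    Short : Fin m → Fin m → ℕ → Set
    Short x y b = ∃[ k ] (k ≤ b × Walk H x y k)

    short-++ : ∀ {x y z a b} → Short x y a → Short y z b → Short x z (a + b)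
    short-++ (k , k≤ , p) (l , l≤ , q) = k + l , +-mono-≤ k≤ l≤ , p ++ʷ q

    hop : ∀ {x h} → x ≡ h ⊎ Edge H x h → Short x h 1
    hop (inj₁ refl) = 0 , z≤n , nil
    hop (inj₂ e)    = 1 , s≤s z≤n , cons e nil

    hop-sym : ∀ {x h} → x ≡ h ⊎ Edge H x h → h ≡ x ⊎ Edge H h x
    hop-sym = [ inj₁ ∘ ≡-sym , inj₂ ∘ edge-sym H ]′

    bridge : ∀ {h k} → h ≡ c ⊎ h ≡ d → k ≡ c ⊎ k ≡ d → h ≡ k ⊎ Edge H h k
    bridge (inj₁ refl) (inj₁ refl) = inj₁ refl
    bridge (inj₁ refl) (inj₂ refl) = inj₂ cd
    bridge (inj₂ refl) (inj₁ refl) = inj₂ (edge-sym H cd)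
    bridge (inj₂ refl) (inj₂ refl) = inj₁ refl

    -- One step to a centre, at most one across `c d`, and one step out. A diametral pair therefore
    -- cannot consist of two near vertices.
    near-near : ∀ {x y} → Near x → Near y → Short x y 3
    near-near (h , h∈ , xh) (k , k∈ , yk) =
      short-++ (hop xh) (short-++ (hop (bridge h∈ k∈)) (hop (hop-sym yk)))

    u v : Fin m
    u = proj₁ (proj₂ diameter)
    v = proj₁ (proj₂ (proj₂ diameter))

    far : ¬ (Near u × Near v)
    far (nu , nv) = let k , k≤3 , w = near-near nu nv in
      <⇒≱ (s≤s k≤3) (proj₂ (proj₂ (proj₂ diameter)) k w)

    σ₆-near : ∀ i → Near (σ₆ i)
    σ₆-near zero                                     = c , inj₁ refl , inj₁ refl
    σ₆-near (suc zero)                               = d , inj₂ refl , inj₁ refl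
    σ₆-near (suc (suc zero))                         = c , inj₁ refl , inj₂ (edge-sym H cp)
    σ₆-near (suc (suc (suc zero)))                   = c , inj₁ refl , inj₂ (edge-sym H cq)
    σ₆-near (suc (suc (suc (suc zero))))             = d , inj₂ refl , inj₂ (edge-sym H dr)
    σ₆-near (suc (suc (suc (suc (suc zero)))))       = d , inj₂ refl , inj₂ (edge-sym H ds)

    -- All six vertices of the copy are near, so one of the diametral ends lies outside it.
    outside-vertex : ∃[ t ] (∀ i → σ₆ i ≢ t)
    outside-vertex with any? (λ i → σ₆ i ≟ u) | any? (λ i → σ₆ i ≟ v)
    ... | no ∉  | _     = u , λ i eq → ∉ (i , eq)
    ... | _     | no ∉  = v , λ i eq → ∉ (i , eq)
    ... | yes (i , refl) | yes (j , eq) = ⊥-elim (far (σ₆-near i , subst Near eq (σ₆-near j)))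

    t : Fin m
    t = proj₁ outside-vertex

    σ₇ : Fin 7 → Fin m
    σ₇ = extend t σ₆

    σ₇-injective : ∀ i j → σ₇ i ≡ σ₇ j → i ≡ j
    σ₇-injective = extend-injective (lookup-injective distinct) (proj₂ outside-vertex)

  doubleStar⇒7≤m : 7 ≤ m
  doubleStar⇒7≤m = injective⇒≤ λ {i} {j} → σ₇-injective i j

  module _ (m≤7 : m ≤ 7) where

    private
      everywhere-near : Near t → ∀ x → Near x
      everywhere-near near-t x with injective⇒onto σ₇ σ₇-injective m≤7 x
      ... | zero  , refl = near-t
      ... | suc i , refl = σ₆-near i

      t-not-near : ¬ Near t
      t-not-near near-t = far (everywhere-near near-t u , everywhere-near near-t v)

      attachment : ∃[ i ] Edge H t (σ₆ i)
      attachment = first refl (proj₂ (proj₁ tree t c))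
        where
        -- The first edge of a walk from `t` to `c` ends in the copy, because `t` is the only vertex
        -- outside it.
        first : ∀ {y k} → y ≡ c → Walk H t y k → ∃[ i ] Edge H t (σ₆ i)
        first t≡c nil = ⊥-elim (t-not-near (c , inj₁ refl , inj₁ t≡c))
        first _ (cons {w = w} e _) with injective⇒onto σ₇ σ₇-injective m≤7 w
        ... | zero  , refl = ⊥-elim (edge-irrefl H e)
        ... | suc i , refl = i , e

      DistinctEntries : (π : Vec (Fin 7) 7) → Set
      DistinctEntries π = ∀ i j → lookup π i ≡ lookup π j → i ≡ j

      distinctEntries? : ∀ π → Dec (DistinctEntries π)
      distinctEntries? π = all? λ i → all? λ j → (lookup π i ≟ lookup π j) →-dec (i ≟ j)

      -- Entry `i` of `π` places vertex `i` of `Sp11-12`, where 0 stands for `t` and 1 to 6 for `c`,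
      -- `d`, `p`, `q`, `r`, `s`.
      copy : ∀ π → {_ : True (distinctEntries? π)} →
        All.All (λ (i , j) → Edge H (σ₇ (lookup π i)) (σ₇ (lookup π j))) spEdges →
        Isomorphic H Sp11-12
      copy π {inj} = Sp-copy⇒isomorphic (proj₂ tree) m≤7 (σ₇ ∘ lookup π)
        λ i j → toWitness inj i j ∘ σ₇-injective _ _

    doubleStar⇒isomorphic : Isomorphic H Sp11-12
    doubleStar⇒isomorphic = attach attachment
      where
      dc = edge-sym H cd

      attach : ∃[ i ] Edge H t (σ₆ i) → Isomorphic H Sp11-12
      attach (zero , e)       = ⊥-elim (t-not-near (c , inj₁ refl , inj₂ e))
      attach (suc zero , e)   = ⊥-elim (t-not-near (d , inj₂ refl , inj₂ e))
      -- With `t` at `p` or `q` the long leg starts at `c`, so `c` plays centre 1 and `d` centre 0;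
      -- with `t` at `r` or `s` the centres trade roles.
      attach (suc (suc zero) , e) =
        copy (# 2 ∷ # 1 ∷ # 5 ∷ # 6 ∷ # 4 ∷ # 3 ∷ # 0 ∷ [])
          (dc ∷ dr ∷ ds ∷ cq ∷ cp ∷ edge-sym H e ∷ [])
      attach (suc (suc (suc zero)) , e) =
        copy (# 2 ∷ # 1 ∷ # 5 ∷ # 6 ∷ # 3 ∷ # 4 ∷ # 0 ∷ [])
          (dc ∷ dr ∷ ds ∷ cp ∷ cq ∷ edge-sym H e ∷ [])
      attach (suc (suc (suc (suc zero))) , e) =
        copy (# 1 ∷ # 2 ∷ # 3 ∷ # 4 ∷ # 6 ∷ # 5 ∷ # 0 ∷ [])
          (cd ∷ cp ∷ cq ∷ ds ∷ dr ∷ edge-sym H e ∷ [])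
      attach (suc (suc (suc (suc (suc zero)))) , e) =
        copy (# 1 ∷ # 2 ∷ # 3 ∷ # 4 ∷ # 5 ∷ # 6 ∷ # 0 ∷ [])
          (cd ∷ cp ∷ cq ∷ dr ∷ ds ∷ edge-sym H e ∷ [])

-- A graph whose IR-graph is Sp(1,1;1,2)

irredundant? : ∀ {n} (G : Graph n) D → Dec (Irredundant G D)
irredundant? G D = all? λ v → (v ∈? D) →-dec any? λ w →
  closedNbr? v w ×-dec all? λ u → (u ∈? D) →-dec ¬? (u ≟ v) →-dec ¬? (closedNbr? u w)
  where
  closedNbr? : ∀ v w → Dec (InClosedNbr G v w)
  closedNbr? v w = (w ≟ v) ⊎-dec T? (adj G v w)

_≟ˢ_ : ∀ {n} (D E : Subset n) → Dec (D ≡ E)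
_≟ˢ_ = Vec.≡-dec Bool._≟_

irAdj? : ∀ {n} (G : Graph n) D E → Dec (IRAdj G D E)
irAdj? G D E = any? λ u → any? λ v →
  (u ∈? D) ×-dec (v ∈? E) ×-dec T? (adj G u v) ×-dec (E ≟ˢ swap D u v)

setOf : ∀ {n} → List (Fin n) → Subset n
setOf = foldr (λ x D → ⁅ x ⁆ ∪ D) ∅

adjacency : Vec (Subset 7) 7
adjacency =
  setOf (# 1 ∷ # 2 ∷ # 3 ∷ # 6 ∷ []) ∷
  setOf (# 0 ∷ # 4 ∷ # 6 ∷ []) ∷
  setOf (# 0 ∷ # 5 ∷ # 6 ∷ []) ∷
  setOf (# 0 ∷ # 5 ∷ []) ∷
  setOf (# 1 ∷ # 5 ∷ # 6 ∷ []) ∷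
  setOf (# 2 ∷ # 3 ∷ # 4 ∷ []) ∷
  setOf (# 0 ∷ # 1 ∷ # 2 ∷ # 4 ∷ []) ∷ []

G₇ : Graph 7
G₇ = record
  { adj    = adj₇
  ; sym    = toWitness {a? = all? λ u → all? λ v → adj₇ u v Bool.≟ adj₇ v u} tt
  ; irrefl = toWitness {a? = all? λ u → adj₇ u u Bool.≟ false} tt
  }
  where
  adj₇ : Fin 7 → Fin 7 → Bool
  adj₇ u v = lookup (lookup adjacency u) v

-- Listed in the order of the vertices of `Sp11-12`. In the notation of `ThreeSwaps`, {0,1,2} is
-- `X`, {1,2,3} and {2,3,4} are `W₁` and `W₂`, the flip {3,4,5} is `W₃`, and {0,1,3} and {2,4,5} are
-- `Q` and `Q′`; the seventh set {0,2,6} hangs at `X`.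
IRSets : Vec (Subset 7) 7
IRSets =
  setOf (# 2 ∷ # 3 ∷ # 4 ∷ []) ∷
  setOf (# 1 ∷ # 2 ∷ # 3 ∷ []) ∷
  setOf (# 2 ∷ # 4 ∷ # 5 ∷ []) ∷
  setOf (# 3 ∷ # 4 ∷ # 5 ∷ []) ∷
  setOf (# 0 ∷ # 1 ∷ # 3 ∷ []) ∷
  setOf (# 0 ∷ # 1 ∷ # 2 ∷ []) ∷
  setOf (# 0 ∷ # 2 ∷ # 6 ∷ []) ∷ []

Catalogued : Subset 7 → Set
Catalogued D = ∣ D ∣ < 3 ⊎ (∣ D ∣ ≡ 3 × ∃[ i ] lookup IRSets i ≡ D)

catalogued? : ∀ D → Dec (Catalogued D)
catalogued? D = (∣ D ∣ ℕ.<? 3) ⊎-dec (∣ D ∣ ℕ.≟ 3) ×-dec any? λ i → lookup IRSets i ≟ˢ D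

-- Settled by a search through all 128 subsets. It yields both the bound 3 on the size of
-- irredundant sets and the completeness of the list.
irredundant⇒catalogued : ∀ D → Irredundant G₇ D → Catalogued D
irredundant⇒catalogued D irr = decidable-stable (catalogued? D) λ ¬cat →
  toWitnessFalse {a? = anySubset? λ D → ¬? (catalogued? D) ×-dec irredundant? G₇ D} tt
    (D , ¬cat , irr)

irredundant⇒∣D∣≤3 : ∀ D → Irredundant G₇ D → ∣ D ∣ ≤ 3
irredundant⇒∣D∣≤3 D irr with irredundant⇒catalogued D irr
... | inj₁ ∣D∣<3       = ℕ.<⇒≤ ∣D∣<3
... | inj₂ (∣D∣≡3 , _) = ℕ.≤-reflexive ∣D∣≡3

IRSets-size : ∀ i → ∣ lookup IRSets i ∣ ≡ 3
IRSets-size = toWitness {a? = all? λ i → ∣ lookup IRSets i ∣ ℕ.≟ 3} tt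

Sp≅G₇[IR] : IsoToIRGraph Sp11-12 G₇
Sp≅G₇[IR] = lookup IRSets , are-IRSets , distinct , complete , λ i j → mk⇔ (to i j) (from i j)
  where
  are-IRSets : ∀ i → IsIRSet G₇ (lookup IRSets i)
  are-IRSets i = toWitness {a? = all? λ i → irredundant? G₇ (lookup IRSets i)} tt i ,
    λ D irr → subst (∣ D ∣ ≤_) (≡-sym (IRSets-size i)) (irredundant⇒∣D∣≤3 D irr)

  distinct : ∀ i j → lookup IRSets i ≡ lookup IRSets j → i ≡ j
  distinct = toWitness {a? = all? λ i → all? λ j →
    (lookup IRSets i ≟ˢ lookup IRSets j) →-dec (i ≟ j)} tt

  complete : ∀ D → IsIRSet G₇ D → ∃[ i ] lookup IRSets i ≡ D
  complete D (irr , max) with irredundant⇒catalogued D irr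
  ... | inj₂ (_ , found) = found
  ... | inj₁ ∣D∣<3 = contradiction (max (lookup IRSets zero) (proj₁ (are-IRSets zero))) (<⇒≱ ∣D∣<3)

  to : ∀ i j → Edge Sp11-12 i j → IRAdj G₇ (lookup IRSets i) (lookup IRSets j)
  to = toWitness {a? = all? λ i → all? λ j →
    T? (spAdj i j) →-dec irAdj? G₇ (lookup IRSets i) (lookup IRSets j)} tt

  from : ∀ i j → IRAdj G₇ (lookup IRSets i) (lookup IRSets j) → Edge Sp11-12 i j
  from = toWitness {a? = all? λ i → all? λ j →
    irAdj? G₇ (lookup IRSets i) (lookup IRSets j) →-dec T? (spAdj i j)} tt

IRTree⇒doubleStar : ∀ {m} {T : Graph m} → IsIRTree T → HasDiameter T 4 → DoubleStar T
IRTree⇒doubleStar ((_ , acyclic) , _ , G , iso) = diameter-4⇒doubleStar {G = G} iso acyclic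

theorem5p5 : (IsIRTree Sp11-12 × HasDiameter Sp11-12 4) ×
    (∀ m (T : Graph m) → IsIRTree T → HasDiameter T 4 → 7 ≤ m) ×
    (∀ m (T : Graph m) → IsIRTree T → HasDiameter T 4 → m ≤ 7 →
    Isomorphic T Sp11-12)
theorem5p5 =
  (((Sp-connected , Sp-acyclic) , 7 , G₇ , Sp≅G₇[IR]) , Sp-diameter) ,
  (λ m T ir diam → doubleStar⇒7≤m (proj₁ ir) diam (IRTree⇒doubleStar ir diam)) ,
  (λ m T ir diam → doubleStar⇒isomorphic (proj₁ ir) diam (IRTree⇒doubleStar ir diam))
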